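{- Let $k,l\geq 3$ be integers and let $i\in\{0,1,2\}$ be such that $2k\equiv i \pmod 3$. If $l\leq k\leq \frac{3l+i-3}{2}$, then $\eta(k,l)=4k$.
   Context: All graphs are finite and simple. The odd-girth of a graph is the length of its shortest odd cycle. $C_n$ denotes the cycle of length $n$. A homomorphism from $G$ to $H$ is a map $V(G)\to V(H)$ sending adjacent vertices to adjacent vertices. For positive integers $k,l$, $\eta(k,l)$ denotes the smallest number of vertices of a graph of odd-girth $2k+1$ that admits no homomorphism to $C_{2l+1}$. -}

module Defs where

open import Data.Nat using (ℕ; suc; _+_; _*_; _≤_; _<_)
open import Data.Fin using (Fin; toℕ)
open import Data.Product using (Σ; ∃; _×_)
open import Data.Sum using (_⊎_)
open import Relation.Nullary using (¬_)
open import Relation.Binary.PropositionalEquality using (_≡_)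
open import Function.Definitions using (Injective)

record Graph : Set₁ where
  field
    n     : ℕ
    Adj   : Fin n → Fin n → Set
    sym   : ∀ {u v} → Adj u v → Adj v u
    irref : ∀ {u} → ¬ Adj u u

open Graph public

CycleNext : (m : ℕ) → Fin m → Fin m → Set
CycleNext m i j = (toℕ j ≡ suc (toℕ i)) ⊎ (suc (toℕ i) ≡ m × toℕ j ≡ 0)

CycleAdj : (m : ℕ) → Fin m → Fin m → Set
CycleAdj m i j = CycleNext m i j ⊎ CycleNext m j i

HasCycle : Graph → ℕ → Set
HasCycle G m =
  3 ≤ m × Σ (Fin m → Fin (n G)) λ c →
    Injective _≡_ _≡_ c × (∀ i j → CycleAdj m i j → Adj G (c i) (c j))

OddGirth : Graph → ℕ → Set
OddGirth G g =
  (∃ λ j → g ≡ 2 * j + 1) × HasCycle G g ×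
  (∀ j → 2 * j + 1 < g → ¬ HasCycle G (2 * j + 1))

HomToCycle : Graph → ℕ → Set
HomToCycle G m =
  Σ (Fin (n G) → Fin m) λ f → ∀ u v → Adj G u v → CycleAdj m (f u) (f v)

IsEta : ℕ → ℕ → ℕ → Set₁
IsEta k l N =
  (Σ Graph λ G → n G ≡ N × OddGirth G (2 * k + 1) × ¬ HomToCycle G (2 * l + 1)) ×
  (∀ (G : Graph) → OddGirth G (2 * k + 1) → ¬ HomToCycle G (2 * l + 1) → N ≤ n G)

{-# OPTIONS --safe #-}

-- Lower bound.  It suffices to map every graph A on fewer than 4k vertices
-- without odd closed walks shorter than 2k+1 to any target containing a closed
-- walk of length 2k+1.  Identifying two neighbours u, v of a vertex creates no
-- shorter odd closed walk unless u and v are joined by a walk of length 2k-1, so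
-- by induction on the order any two neighbours of a vertex w may be assumed to
-- lie with w on a (2k+1)-cycle.  If w has three neighbours a, b, c, the three
-- cycles consist of six geodesics ("arms") from w of length k.  An arm can only
-- meet the arm with the same first vertex or the arm whose cycle continues to
-- the same third neighbour, and the odd closed walk obtained as the sum of the
-- three cycles bounds the number of meetings by 2k+1; hence there are at least
-- 1 + 6k - (2k+1) = 4k vertices.  Otherwise the graph is a (2k+1)-cycle.
--
-- Upper bound.  Subdivide K₄ so that opposite edges become paths of equal
-- length, with lengths a, b, c ≤ l summing to 2k+1.  Giving all triangles the
-- same 2k+1 edge colours, each once, shows that every odd closed walk uses every
-- colour.  A homomorphism to C_{2l+1} would have winding number 0 along the
-- three quadrilaterals, as these are too short, and hence along the odd
-- triangles, which is absurd.
module Submission where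

open import Defs
open import Data.Nat using (ℕ; _+_; _*_; _∸_; _≤_; _%_)
open import Relation.Binary.PropositionalEquality using (_≡_)

open import Data.Bool using (Bool; false; not)
open import Data.Bool.Properties using (not-involutive; not-¬)
open import Data.Empty using (⊥; ⊥-elim)
open import Data.Fin as Fin using (Fin; toℕ; fromℕ<; punchIn; punchOut)
open import Data.Fin.Patterns
import Data.Fin.Properties as Fin
open import Data.Integer as ℤ using (ℤ; -_; 0ℤ; 1ℤ) renaming (_+_ to _+ᶻ_; _*_ to _*ᶻ_; _-_ to _-ᶻ_)
import Data.Integer.Properties as ℤ
import Data.Integer.Tactic.RingSolver as ℤ
open import Algebra.Properties.AbelianGroup ℤ.+-0-abelianGroup using (∙-cancelˡ)
open import Data.List using (List; []; _∷_; lookup; length; applyUpTo; concat; map; _++_)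
open import Data.List.Membership.Propositional using (_∈_)
open import Data.List.Membership.Propositional.Properties using (∈-lookup; ∈-applyUpTo⁻; ∈-concat⁻′; ∈-map⁻)
open import Data.List.Properties using (length-applyUpTo; length-++)
open import Data.List.Relation.Binary.Disjoint.Propositional using (Disjoint)
open import Data.List.Relation.Unary.All as All using ([]; _∷_)
import Data.List.Relation.Unary.All.Properties as All
open import Data.List.Relation.Unary.AllPairs as AllPairs using (AllPairs; []; _∷_)
import Data.List.Relation.Unary.AllPairs.Properties as AllPairs
open import Data.List.Relation.Unary.Unique.Propositional using (Unique)
import Data.List.Relation.Unary.Unique.Propositional.Properties as Unique
open import Data.Nat using (zero; suc; _<_; _/_; z≤n; s≤s; s≤s⁻¹)
open import Data.Nat.DivMod using (m≡m%n+[m/n]*n; m%n<n)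
open import Data.Nat.Induction using (<-rec)
open import Data.Nat.ListAction using (sum)
open import Data.Nat.Properties
open import Data.Nat.Tactic.RingSolver using (solve-∀)
open import Data.Product using (Σ; ∃; _×_; _,_; proj₁; proj₂)
open import Data.Product.Function.NonDependent.Propositional using (_×-↔_)
open import Data.Sum as Sum using (_⊎_; inj₁; inj₂)
open import Data.Sum.Function.Propositional using (_⊎-↔_)
open import Function using (_∘_; _↔_; Inverse)
open import Function.Construct.Composition using (_↔-∘_)
open import Function.Construct.Identity using (↔-id)
open import Level using (0ℓ)
open import Relation.Binary using (Rel; Symmetric; Decidable; tri<; tri≈; tri>)
open import Relation.Binary.PropositionalEquality using (_≢_; refl; cong; cong₂; subst; subst₂; trans; module ≡-Reasoning) renaming (sym to ≡-sym)
open import Relation.Nullary using (¬_; Dec; yes; no; contradiction)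
open import Relation.Nullary.Decidable using (_×-dec_; ¬?; map′; decidable-stable; ¬¬-excluded-middle)

-- Parity of natural numbers.

parity : ∀ m → (∃ λ h → m ≡ h + h) ⊎ (∃ λ h → m ≡ suc (h + h))
parity zero    = inj₁ (0 , refl)
parity (suc m) with parity m
... | inj₁ (h , refl) = inj₂ (h , refl)
... | inj₂ (h , refl) = inj₁ (suc h , cong suc (≡-sym (+-suc h h)))

double≢odd : ∀ h j → h + h ≢ suc (j + j)
double≢odd h j eq = even≢odd h j (trans (double h) (trans eq (cong suc (≡-sym (double j)))))
  where
  double : ∀ h → 2 * h ≡ h + h
  double = solve-∀

odd-+ : ∀ m n {j} → m + n ≡ suc (j + j) →
        (∃ λ h → m ≡ suc (h + h)) ⊎ (∃ λ h → n ≡ suc (h + h))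
odd-+ m n {j} eq with parity m | parity n
... | inj₂ o | _ = inj₁ o
... | _ | inj₂ o = inj₂ o
... | inj₁ (h , refl) | inj₁ (i , refl) =
  contradiction (trans (shuffle h i) eq) (double≢odd (h + i) j)
  where
  shuffle : ∀ h i → (h + i) + (h + i) ≡ (h + h) + (i + i)
  shuffle = solve-∀

double-<⁻ : ∀ {h k} → suc (h + h) < suc (k + k) → h < k
double-<⁻ {h} {k} lt with h <? k
... | yes h<k = h<k
... | no h≮k = contradiction lt (≤⇒≯ (s≤s (+-mono-≤ (≮⇒≥ h≮k) (≮⇒≥ h≮k))))

-- Walks in a binary relation.

infixr 5 _∷_

data Walk {V : Set} (A : Rel V 0ℓ) : ℕ → Rel V 0ℓ where
  []  : ∀ {u} → Walk A 0 u u
  _∷_ : ∀ {m u v x} → A u v → Walk A m v x → Walk A (suc m) u x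

module _ {V : Set} {A : Rel V 0ℓ} where

  infixr 5 _++ʷ_

  _++ʷ_ : ∀ {m n u v x} → Walk A m u v → Walk A n v x → Walk A (m + n) u x
  []      ++ʷ q = q
  (e ∷ p) ++ʷ q = e ∷ (p ++ʷ q)

  _∷ʳʷ_ : ∀ {m u v x} → Walk A m u v → A v x → Walk A (suc m) u x
  []      ∷ʳʷ e = e ∷ []
  (d ∷ p) ∷ʳʷ e = d ∷ (p ∷ʳʷ e)

  reverseʷ : Symmetric A → ∀ {m u v} → Walk A m u v → Walk A m v u
  reverseʷ sy []      = []
  reverseʷ sy (e ∷ p) = reverseʷ sy p ∷ʳʷ sy e

  splitʷ : ∀ m {n u v} → Walk A (m + n) u v → ∃ λ x → Walk A m u x × Walk A n x v
  splitʷ zero    p       = _ , [] , p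
  splitʷ (suc m) (e ∷ p) with x , q , r ← splitʷ m p = x , e ∷ q , r

  -- Each unit of `d` inserts a step from `u` to `x` and back.
  lengthen : Symmetric A → ∀ {m u v x} → A u x → Walk A m u v →
    ∀ d → Walk A ((d + d) + m) u v
  lengthen sy ux p zero = p
  lengthen sy {m} {u} {v} ux p (suc d) =
    subst (λ l → Walk A (suc l + m) u v) (≡-sym (+-suc d d)) (ux ∷ sy ux ∷ lengthen sy ux p d)

  -- Beyond the length of the walk the value is its last vertex.
  at : ∀ {m u v} → Walk A m u v → ℕ → V
  at {u = u} p       zero    = u
  at {u = u} []      (suc i) = u
  at         (e ∷ p) (suc i) = at p i

  at-last : ∀ {m u v} (p : Walk A m u v) → at p m ≡ v
  at-last []      = refl
  at-last (e ∷ p) = at-last p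

  -- A walk read as a function on ℕ, so that positions can be compared and cut by arithmetic; only
  -- the values up to `m` matter.
  Trail : ℕ → (ℕ → V) → Set
  Trail m f = ∀ {i} → i < m → A (f i) (f (suc i))

  at-trail : ∀ {m u v} (p : Walk A m u v) → Trail m (at p)
  at-trail (e ∷ [])    {zero}  _  = e
  at-trail (e ∷ d ∷ p) {zero}  _  = e
  at-trail (e ∷ p)     {suc i} lt = at-trail p (s≤s⁻¹ lt)

  segment : ∀ {m f} → Trail m f → ∀ i d → i + d ≤ m → Walk A d (f i) (f (i + d))
  segment {f = f} t i zero le = subst (λ j → Walk A 0 (f i) (f j)) (≡-sym (+-identityʳ i)) []
  segment {m} {f} t i (suc d) le =
    t (≤-trans (m≤m+n (suc i) d) le′) ∷
    subst (λ j → Walk A d (f (suc i)) (f j)) (≡-sym (+-suc i d)) (segment t (suc i) d le′)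
    where le′ = subst (_≤ m) (+-suc i d) le

  seg : ∀ {m f} → Trail m f → ∀ {i j} → i ≤ j → j ≤ m → Walk A (j ∸ i) (f i) (f j)
  seg {m} {f} t {i} {j} i≤j j≤m =
    subst (λ h → Walk A (j ∸ i) (f i) (f h)) (m+[n∸m]≡n i≤j)
      (segment t i (j ∸ i) (subst (_≤ m) (≡-sym (m+[n∸m]≡n i≤j)) j≤m))

-- On values of `toℕ` this is definitionally `CycleNext`.
CyclicNext : ℕ → Rel ℕ 0ℓ
CyclicNext m i j = (j ≡ suc i) ⊎ (suc i ≡ m × j ≡ 0)

closed-trail : ∀ {V : Set} {A : Rel V 0ℓ} {m f} → Trail {A = A} m f → f 0 ≡ f m →
  ∀ {i j} → i < m → CyclicNext m i j → A (f i) (f j)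
closed-trail t cl i<m (inj₁ refl) = t i<m
closed-trail {A = A} {f = f} t cl {i} i<m (inj₂ (last , refl)) =
  subst (A (f i)) (trans (cong f last) (≡-sym cl)) (t i<m)

map-walk : ∀ {V W : Set} {A : Rel V 0ℓ} {B : Rel W 0ℓ} {f : V → W} →
           (∀ {x y} → A x y → B (f x) (f y)) →
           ∀ {m u v} → Walk A m u v → Walk B m (f u) (f v)
map-walk h []      = []
map-walk h (e ∷ p) = h e ∷ map-walk h p

walk? : ∀ {n} {A : Rel (Fin n) 0ℓ} → Decidable A → ∀ m → Decidable (Walk A m)
walk? A? zero u v = map′ (λ { refl → [] }) (λ { [] → refl }) (u Fin.≟ v)
walk? A? (suc m) u v = map′ (λ { (_ , e , p) → e ∷ p }) (λ { (e ∷ p) → _ , e , p })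
  (Fin.any? λ x → A? u x ×-dec walk? A? m x v)

-- Having `m` with an equation allows a concatenated walk to be refuted at its computed length,
-- without transport.
NoShortOdd : {V : Set} → Rel V 0ℓ → ℕ → Set
NoShortOdd A k = ∀ {m u} j → m ≡ suc (j + j) → j < k → ¬ Walk A m u u

-- A closed walk of odd length that repeats a vertex splits into two closed
-- walks, one of which is odd.
module _ {V : Set} {A : Rel V 0ℓ} where

  shorten-closed : ∀ {f j} → Trail {A = A} (suc (j + j)) f → f 0 ≡ f (suc (j + j)) →
    ∀ {a b} → a < b → b < suc (j + j) → f a ≡ f b →
    ∃ λ h → h < j × ∃ λ x → Walk A (suc (h + h)) x x
  shorten-closed {f} {j} t closed {a} {b} a<b b<m fa≡fb
    with odd-+ (b ∸ a) ((m ∸ b) + a) {j} len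
    where
    m = suc (j + j)
    len : (b ∸ a) + ((m ∸ b) + a) ≡ m
    len = trans (shuffle (b ∸ a) (m ∸ b) a)
            (trans (cong ((m ∸ b) +_) (m∸n+n≡m (<⇒≤ a<b))) (m∸n+n≡m (<⇒≤ b<m)))
      where
      shuffle : ∀ x y z → x + (y + z) ≡ y + (x + z)
      shuffle = solve-∀
  ... | inj₁ (h , eq) = h , double-<⁻ (subst (_< suc (j + j)) eq (≤-<-trans (m∸n≤m b a) b<m)) , f a ,
    subst (λ d → Walk A d (f a) (f a)) eq
      (subst (Walk A (b ∸ a) (f a)) (≡-sym fa≡fb) (seg t (<⇒≤ a<b) (<⇒≤ b<m)))
  ... | inj₂ (h , eq) = h , double-<⁻ (subst (_< m) eq short) , f a ,
    subst (λ d → Walk A d (f a) (f a)) eq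
      (subst (λ x → Walk A (m ∸ b) x (f 0)) (≡-sym fa≡fb)
         (subst (Walk A (m ∸ b) (f b)) (≡-sym closed) (seg t (<⇒≤ b<m) ≤-refl))
       ++ʷ seg t z≤n (<⇒≤ (<-trans a<b b<m)))
    where
    m = suc (j + j)
    short : (m ∸ b) + a < m
    short = subst ((m ∸ b) + a <_) (m∸n+n≡m (<⇒≤ b<m)) (+-monoʳ-< (m ∸ b) a<b)

-- Odd cycles inside odd closed walks.

module _ (G : Graph) where

  -- Strong induction: a repeated vertex yields a shorter odd closed walk, and a walk without
  -- repetition is itself a cycle. Length one would be a loop.
  odd-cycle : ∀ j {u} → Walk (Adj G) (suc (j + j)) u u →
    ∃ λ h → h ≤ j × HasCycle G (suc (h + h))
  odd-cycle = <-rec _ step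
    where
    step : ∀ j → (∀ {i} → i < j → ∀ {u} → Walk (Adj G) (suc (i + i)) u u →
             ∃ λ h → h ≤ i × HasCycle G (suc (h + h))) →
           ∀ {u} → Walk (Adj G) (suc (j + j)) u u →
           ∃ λ h → h ≤ j × HasCycle G (suc (h + h))
    step zero _ (e ∷ []) = contradiction e (irref G)
    step j@(suc i) rec p
      with anyUpTo? (λ b → anyUpTo? (λ a → at p a Fin.≟ at p b) b) (suc (j + j))
    ... | yes (b , b<m , a , a<b , eq)
      with h , h<j , x , q ← shorten-closed {j = j} (at-trail p) (≡-sym (at-last p)) a<b b<m eq
      with g , g≤h , c ← rec h<j q = g , ≤-trans g≤h (<⇒≤ h<j) , c
    ... | no inj = j , ≤-refl , s≤s (s≤s (subst (1 ≤_) (≡-sym (+-suc i i)) (s≤s z≤n))) ,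
      at p ∘ toℕ , injective ,
      λ { a b (inj₁ next) → step′ a next
        ; a b (inj₂ next) → Graph.sym G (step′ b next) }
      where
      step′ : ∀ a {b} → CyclicNext (suc (j + j)) (toℕ a) b → Adj G (at p (toℕ a)) (at p b)
      step′ a = closed-trail {A = Adj G} (at-trail p) (≡-sym (at-last p)) (Fin.toℕ<n a)
      injective : ∀ {a b} → at p (toℕ a) ≡ at p (toℕ b) → a ≡ b
      injective {a} {b} eq with <-cmp (toℕ a) (toℕ b)
      ... | tri< lt _ _ = contradiction (_ , Fin.toℕ<n b , _ , lt , eq) inj
      ... | tri≈ _ e _  = Fin.toℕ-injective e
      ... | tri> _ _ gt = contradiction (_ , Fin.toℕ<n a , _ , gt , ≡-sym eq) inj

-- Counting and bounded search.

unique-length : ∀ {n} {xs : List (Fin n)} → Unique xs → length xs ≤ n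
unique-length {xs = xs} u = Fin.injective⇒≤ (lookup-injective u)
  where
  lookup-injective : ∀ {xs} → Unique xs → ∀ {i j} → lookup xs i ≡ lookup xs j → i ≡ j
  lookup-injective (_ ∷ _)  {Fin.zero}  {Fin.zero}  _  = refl
  lookup-injective (d ∷ _)  {Fin.zero}  {Fin.suc j} eq = contradiction eq (All.lookup d (∈-lookup j))
  lookup-injective (d ∷ _)  {Fin.suc i} {Fin.zero}  eq = contradiction (≡-sym eq) (All.lookup d (∈-lookup i))
  lookup-injective (_ ∷ us) {Fin.suc i} {Fin.suc j} eq = cong Fin.suc (lookup-injective us eq)

module _ {P : ℕ → Set} (P? : ∀ i → Dec (P i)) where

  last-below : P 0 → ∀ m → ∃ λ p → p ≤ m × P p × (∀ {j} → p < j → j ≤ m → ¬ P j)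
  last-below P0 zero = 0 , z≤n , P0 , λ 0<j j≤0 → contradiction j≤0 (<⇒≱ 0<j)
  last-below P0 (suc m) with P? (suc m)
  ... | yes Pm = suc m , ≤-refl , Pm , λ m<j j≤m → contradiction j≤m (<⇒≱ m<j)
  ... | no ¬Pm with p , p≤m , Pp , after ← last-below P0 m =
    p , m≤n⇒m≤1+n p≤m , Pp , λ {j} p<j j≤1+m → case≤ p<j (m≤n⇒m<n∨m≡n j≤1+m)
    where
    case≤ : ∀ {j} → p < j → j < suc m ⊎ j ≡ suc m → ¬ P j
    case≤ p<j (inj₁ lt)   = after p<j (s≤s⁻¹ lt)
    case≤ p<j (inj₂ refl) = ¬Pm

  none-or-first : ∀ m → (∀ {j} → j < m → ¬ P j) ⊎ (∃ λ i → i < m × P i × (∀ {j} → j < i → ¬ P j))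
  none-or-first zero = inj₁ λ ()
  none-or-first (suc m) with none-or-first m
  ... | inj₂ (i , i<m , Pi , before) = inj₂ (i , m≤n⇒m≤1+n i<m , Pi , before)
  ... | inj₁ none with P? m
  ...   | yes Pm = inj₂ (m , ≤-refl , Pm , none)
  ...   | no ¬Pm = inj₁ λ {j} j<1+m → case≤ (m≤n⇒m<n∨m≡n (s≤s⁻¹ j<1+m))
    where
    case≤ : ∀ {j} → j < m ⊎ j ≡ m → ¬ P j
    case≤ (inj₁ lt)   = none lt
    case≤ (inj₂ refl) = ¬Pm

-- Arms at a vertex with three neighbours.

module Arms {n κ} {A : Rel (Fin n) 0ℓ} (sy : Symmetric A)
            (noOdd : NoShortOdd A (suc κ)) (w : Fin n) where

  private
    V = Fin n
    k = suc κ

  -- One half of a closed walk of length `2k + 1` through `w`; `back` is the other half, one step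
  -- longer, and serves to exclude shortcuts that save an even number of steps.
  record Arm (s : V) : Set where
    field
      pos   : ℕ → V
      pos-0 : pos 0 ≡ w
      pos-1 : pos 1 ≡ s
      trail : Trail {A = A} k pos
      back  : Walk A (suc k) (pos k) w
  open Arm

  -- A closed walk of length `2k + 1` cut at `w` and at the edge `top` opposite to it.
  record Spindle (s t : V) : Set where
    field
      left  : Arm s
      right : Arm t
      top   : A (pos left k) (pos right k)
  open Spindle

  flip-spindle : ∀ {s t} → Spindle s t → Spindle t s
  flip-spindle S = record { left = right S ; right = left S ; top = sy (top S) }

  private
    from-w : ∀ {s} (F : Arm s) {i} → i ≤ k → Walk A i w (pos F i)
    from-w F {i} i≤k = subst (λ x → Walk A i x (pos F i)) (pos-0 F) (seg (trail F) z≤n i≤k)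

    -- If `i - j` is odd, going out along `G` and home along `F` is an odd closed walk of length
    -- `i + j < 2k`. If it is even, replacing the first `i` steps of the closed walk of `F` by `j`
    -- steps of `G` leaves the odd length `2k + 1 - (i - j)`.
    no-descent : ∀ {s t} (F : Arm s) (G : Arm t) {i j} → j < i → i ≤ k → pos F i ≢ pos G j
    no-descent F G {i} {j} j<i i≤k eq with parity (i ∸ j)
    ... | inj₂ (h , d≡) = noOdd (j + h)
        (trans (cong (j +_) i≡) (arith j h))
        (≤-trans (s≤s (+-monoʳ-≤ j (m≤m+n h h))) (≤-trans (≤-reflexive (≡-sym (trans i≡ (+-suc j (h + h))))) i≤k))
        (from-w G (≤-trans (<⇒≤ j<i) i≤k) ++ʷ
         subst (λ x → Walk A i x w) eq (reverseʷ sy (from-w F i≤k)))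
      where
      i≡ : i ≡ j + suc (h + h)
      i≡ = trans (≡-sym (m+[n∸m]≡n (<⇒≤ j<i))) (cong (j +_) d≡)
      arith : ∀ j h → j + (j + suc (h + h)) ≡ suc ((j + h) + (j + h))
      arith = solve-∀
    ... | inj₁ (zero , d≡) = contradiction d≡ (m>n⇒m∸n≢0 j<i)
    ... | inj₁ (h@(suc h′) , d≡) = noOdd (j + h + r)
        (trans (cong (λ x → j + (r + suc x)) k≡) (arith j h r))
        (subst (suc (j + h + r) ≤_) (≡-sym (trans k≡ (arith′ j h′ r))) (m≤m+n (suc (j + h + r)) h′))
        (from-w G (≤-trans (<⇒≤ j<i) i≤k) ++ʷ
         subst (λ x → Walk A r x (pos F k)) eq (seg (trail F) i≤k ≤-refl) ++ʷ back F)
      where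
      r = k ∸ i
      k≡ : k ≡ j + (h + h) + r
      k≡ = trans (≡-sym (m+[n∸m]≡n i≤k))
             (cong (_+ r) (trans (≡-sym (m+[n∸m]≡n (<⇒≤ j<i))) (cong (j +_) d≡)))
      arith : ∀ j h r → j + (r + suc (j + (h + h) + r)) ≡ suc ((j + h + r) + (j + h + r))
      arith = solve-∀
      arith′ : ∀ j h r → j + (suc h + suc h) + r ≡ suc (j + suc h + r) + h
      arith′ = solve-∀

  -- Up to level k an arm is a geodesic, so its position can be read off the vertex.
  level : ∀ {s t} (F : Arm s) (G : Arm t) {i j} → i ≤ k → j ≤ k → pos F i ≡ pos G j → i ≡ j
  level F G {i} {j} i≤k j≤k eq with <-cmp i j
  ... | tri< lt _ _ = contradiction (≡-sym eq) (no-descent G F lt j≤k)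
  ... | tri≈ _ e _  = e
  ... | tri> _ _ gt = contradiction eq (no-descent F G gt i≤k)

  own : ∀ {s} (F : Arm s) {j} → j ≤ κ → Walk A j s (pos F (suc j))
  own F {j} j≤κ = subst (λ x → Walk A j x (pos F (suc j))) (pos-1 F) (seg (trail F) (s≤s z≤n) (s≤s j≤κ))

  climb : ∀ {s t} (G : Arm t) {i j} → i ≤ j → j ≤ κ →
          Walk A i s (pos G (suc i)) → Walk A j s (pos G (suc j))
  climb {s} G {i} {j} i≤j j≤κ p =
    subst (λ d → Walk A d s (pos G (suc j))) (m+[n∸m]≡n i≤j) (p ++ʷ seg (trail G) (s≤s i≤j) (s≤s j≤κ))

  -- Both arms reach the common vertex after equally many steps, so changing from `F` to `G` there
  -- keeps the length.
  switch : ∀ {s t} (F : Arm s) (G : Arm t) {j} → j ≤ κ →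
           pos F (suc j) ≡ pos G (suc j) → Walk A κ s (pos G k)
  switch {s} F G {j} j≤κ eq = climb G j≤κ ≤-refl (subst (Walk A j s) eq (own F j≤κ))

  -- Together with `top` the two walks would close up to length `2κ + 1 = 2k - 1`.
  clash : ∀ {s t x} (S : Spindle s t) → Walk A κ x (pos (left S) k) → ¬ Walk A κ x (pos (right S) k)
  clash S p q = noOdd κ (+-suc κ κ) ≤-refl (p ++ʷ top S ∷ reverseʷ sy q)

  Apart : ∀ {s t} → Arm s → Arm t → Set
  Apart F G = ∀ {j} → j ≤ κ → pos F (suc j) ≢ pos G (suc j)

  apart-sym : ∀ {s t} {F : Arm s} {G : Arm t} → Apart F G → Apart G F
  apart-sym ap j≤κ eq = ap j≤κ (≡-sym eq)

  apart-sides : ∀ {s t} (S : Spindle s t) → Apart (left S) (right S)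
  apart-sides S j≤κ eq = clash S (own (left S) ≤-refl) (switch (left S) (right S) j≤κ eq)

  -- A meeting would let `s` reach the far end of `top` in `κ` steps, as it already reaches the near
  -- end.
  apart-sibling : ∀ {s t} (S : Spindle s t) (F : Arm s) → Apart F (right S)
  apart-sibling S F j≤κ eq = clash S (own (left S) ≤-refl) (switch F (right S) j≤κ eq)

  -- Levels `start + 1` to `start + len` of an arm; the shift keeps `w`, at level 0, out of every
  -- arc.
  record Arc : Set where
    constructor arc
    field
      {base} : V
      arm    : Arm base
      start len : ℕ
      fits   : start + len ≤ k

    vertices : List V
    vertices = applyUpTo (λ i → pos arm (suc (start + i))) len
  open Arc

  -- Comparing equal levels suffices for disjointness, since by `level` arms meet only at equal
  -- levels.
  Compatible : Rel Arc 0ℓ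
  Compatible X Y = ∀ {j} → start X ≤ j → j < start X + len X → start Y ≤ j → j < start Y + len Y →
    pos (arm X) (suc j) ≢ pos (arm Y) (suc j)

  private
    in-range : ∀ s l {i} → s + l ≤ k → i < l → s + i ≤ κ
    in-range s l fit i<l = s≤s⁻¹ (≤-trans (+-monoʳ-< s i<l) fit)

    ∈-vertices : ∀ X {v} → v ∈ vertices X →
      ∃ λ j → start X ≤ j × j < start X + len X × j ≤ κ × v ≡ pos (arm X) (suc j)
    ∈-vertices X v∈ with i , i<l , eq ← ∈-applyUpTo⁻ _ v∈ =
      start X + i , m≤m+n _ i , +-monoʳ-< (start X) i<l , in-range (start X) (len X) (fits X) i<l , eq

    vertices-unique : ∀ X → Unique (vertices X)
    vertices-unique X = Unique.applyUpTo⁺₁ _ (len X) λ {i} {j} i<j j<l eq →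
      <⇒≢ i<j (+-cancelˡ-≡ (start X) i j (suc-injective
        (level (arm X) (arm X) (s≤s (bound (<-trans i<j j<l))) (s≤s (bound j<l)) eq)))
      where
      bound : ∀ {i} → i < len X → start X + i ≤ κ
      bound = in-range (start X) (len X) (fits X)

    vertices-disjoint : ∀ X Y → Compatible X Y → Disjoint (vertices X) (vertices Y)
    vertices-disjoint X Y comp (v∈X , v∈Y)
      with i , si , ei , i≤κ , refl ← ∈-vertices X v∈X
      with j , sj , ej , j≤κ , eq ← ∈-vertices Y v∈Y
      with refl ← level (arm X) (arm Y) (s≤s i≤κ) (s≤s j≤κ) eq = comp si ei sj ej eq

    length-concat : ∀ Xs → length (concat (map vertices Xs)) ≡ sum (map len Xs)
    length-concat [] = refl
    length-concat (X ∷ Xs) = trans (length-++ (vertices X))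
      (cong₂ _+_ (length-applyUpTo _ (len X)) (length-concat Xs))

  -- The additional vertex is `w`.
  count-arcs : ∀ Xs → AllPairs Compatible Xs → suc (sum (map len Xs)) ≤ n
  count-arcs Xs comp = subst (_≤ n) (cong suc (length-concat Xs)) (unique-length
    (All.tabulate w∉ ∷ Unique.concat⁺ (All.map⁺ (All.universal vertices-unique Xs))
      (AllPairs.map⁺ (AllPairs.map (λ {X} {Y} → vertices-disjoint X Y) comp))))
    where
    w∉ : ∀ {v} → v ∈ concat (map vertices Xs) → w ≢ v
    w∉ v∈ refl with vs , v∈vs , vs∈ ← ∈-concat⁻′ (map vertices Xs) v∈
      with X , _ , refl ← ∈-map⁻ vertices vs∈
      with j , _ , _ , j≤κ , eq ← ∈-vertices X v∈vs
      with () ← level (arm X) (arm X) z≤n (s≤s j≤κ) (trans (pos-0 (arm X)) eq)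

  private
    full : ∀ {s} → Arm s → Arc
    full F = arc F 0 k ≤-refl

    -- Begins strictly above level `suc p`, the last meeting with the other arm at the same
    -- neighbour.
    upper : ∀ {s} → Arm s → ∀ {p} → p ≤ κ → Arc
    upper F {p} p≤κ = arc F (suc p) (κ ∸ p) (s≤s (≤-reflexive (m+[n∸m]≡n p≤κ)))

    last-meeting : ∀ {s} (F G : Arm s) → ∃ λ p → p ≤ κ × pos F (suc p) ≡ pos G (suc p) ×
      (∀ {j} → p < j → j ≤ κ → pos F (suc j) ≢ pos G (suc j))
    last-meeting F G = last-below (λ j → pos F (suc j) Fin.≟ pos G (suc j))
      (trans (pos-1 F) (≡-sym (pos-1 G))) κ

    up : ∀ {s} (F : Arm s) {i j} → i ≤ j → j ≤ κ → Walk A (j ∸ i) (pos F (suc i)) (pos F (suc j))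
    up F i≤j j≤κ = seg (trail F) (s≤s i≤j) (s≤s j≤κ)

    down : ∀ {s} (F : Arm s) {i j} → i ≤ j → j ≤ κ → Walk A (j ∸ i) (pos F (suc j)) (pos F (suc i))
    down F i≤j j≤κ = reverseʷ sy (up F i≤j j≤κ)

    infixr 5 _++⟨_⟩_
    _++⟨_⟩_ : ∀ {l m u v v′ x} → Walk A l u v → v ≡ v′ → Walk A m v′ x → Walk A (l + m) u x
    p ++⟨ refl ⟩ q = p ++ʷ q

  module _ {a b c : V} where

    -- Now only arms with the same first vertex can meet. With `P`, `Q`, `R` levels above the last
    -- meetings at `a`, `b`, `c`, there are at least `1 + 3k + P + Q + R` vertices, and
    -- `P + Q + R + 1 ≥ k`.
    separated-arms : (S : Spindle a b) (T : Spindle b c) (U : Spindle c a) →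
      Apart (left S) (right T) → Apart (right S) (left U) → Apart (left T) (right U) →
      4 * k ≤ n
    separated-arms S T U ab#cb ba#ca bc#ac
      with p , p≤κ , p≡ , p< ← last-meeting (left S) (right U)
      with q , q≤κ , q≡ , q< ← last-meeting (right S) (left T)
      with r , r≤κ , r≡ , r< ← last-meeting (right T) (left U)
      = ≤-trans (arith κ P Q R k≤) (count-arcs
          -- Of the two arms at each neighbour one counts in full, the other above their last
          -- meeting.
          (full (left S) ∷ full (right S) ∷ full (left U) ∷
           upper (right U) p≤κ ∷ upper (left T) q≤κ ∷ upper (right T) r≤κ ∷ [])
          ( ( (λ _ j< _ _ → apart-sides S (s≤s⁻¹ j<))
            ∷ (λ _ j< _ _ → apart-sibling U′ (left S) (s≤s⁻¹ j<))
            ∷ (λ _ j< p<j _ → p< p<j (s≤s⁻¹ j<))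
            ∷ (λ _ j< _ _ → apart-sym {F = left T} {G = left S} (apart-sibling S′ (left T)) (s≤s⁻¹ j<))
            ∷ (λ _ j< _ _ → ab#cb (s≤s⁻¹ j<)) ∷ [])
          ∷ ( (λ _ j< _ _ → ba#ca (s≤s⁻¹ j<))
            ∷ (λ _ j< _ _ → apart-sym {F = right U} {G = right S} (apart-sibling S (right U)) (s≤s⁻¹ j<))
            ∷ (λ _ j< q<j _ → q< q<j (s≤s⁻¹ j<))
            ∷ (λ _ j< _ _ → apart-sibling T (right S) (s≤s⁻¹ j<)) ∷ [])
          ∷ ( (λ _ j< _ _ → apart-sides U (s≤s⁻¹ j<))
            ∷ (λ _ j< _ _ → apart-sibling T′ (left U) (s≤s⁻¹ j<))
            ∷ (λ _ j< r<j _ eq → r< r<j (s≤s⁻¹ j<) (≡-sym eq)) ∷ [])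
          ∷ ( (λ p<j j< _ _ eq → bc#ac (range p≤κ j<) (≡-sym eq))
            ∷ (λ p<j j< _ _ → apart-sym {F = right T} {G = right U} (apart-sibling U (right T)) (range p≤κ j<)) ∷ [])
          ∷ ( (λ q<j j< _ _ → apart-sides T (range q≤κ j<)) ∷ [])
          ∷ [] ∷ [] ))
      where
      P = κ ∸ p ; Q = κ ∸ q ; R = κ ∸ r
      S′ = flip-spindle S
      T′ = flip-spindle T
      U′ = flip-spindle U
      range : ∀ {p} → p ≤ κ → ∀ {j} → j < suc p + (κ ∸ p) → j ≤ κ
      range p≤κ {j} lt = s≤s⁻¹ (subst (j <_) (cong suc (m+[n∸m]≡n p≤κ)) lt)
      len≡ : ∀ P Q R → P + suc (Q + (Q + suc (R + (R + suc P)))) ≡ suc (suc (P + Q + R) + suc (P + Q + R))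
      len≡ = solve-∀
      -- The parts above the last meetings and the three `top` edges form a closed walk of odd
      -- length `2 (P + Q + R) + 3`.
      k≤ : k ≤ suc (P + Q + R)
      k≤ with suc (P + Q + R) <? k
      ... | no ≮ = ≮⇒≥ ≮
      ... | yes lt = ⊥-elim (noOdd (suc (P + Q + R)) (len≡ P Q R) lt
        (up (left S) p≤κ ≤-refl ++ʷ top S ∷ down (right S) q≤κ ≤-refl ++⟨ q≡ ⟩
         up (left T) q≤κ ≤-refl ++ʷ top T ∷ down (right T) r≤κ ≤-refl ++⟨ r≡ ⟩
         up (left U) r≤κ ≤-refl ++ʷ top U ∷
         subst (Walk A P _) (≡-sym p≡) (down (right U) p≤κ ≤-refl)))
      arith : ∀ κ P Q R → suc κ ≤ suc (P + Q + R) →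
        4 * suc κ ≤ suc (suc κ + (suc κ + (suc κ + (P + (Q + (R + 0))))))
      arith κ P Q R le = subst₂ _≤_ (e₁ κ) (e₂ κ P Q R) (+-monoʳ-≤ (3 * suc κ) le)
        where
        e₁ : ∀ κ → 3 * suc κ + suc κ ≡ 4 * suc κ
        e₁ = solve-∀
        e₂ : ∀ κ P Q R → 3 * suc κ + suc (P + Q + R) ≡ suc (suc κ + (suc κ + (suc κ + (P + (Q + (R + 0))))))
        e₂ = solve-∀

    -- Two arms towards b that merge at level suc i may follow the same
    -- continuation, so only the part of the second one below that level is needed.
    merging-arms : (S : Spindle a b) (U : Spindle a c) (F : Arm c) →
      ∀ {i} → i ≤ κ → pos (left S) (suc i) ≡ pos F (suc i) →
      (∀ {j} → j < i → pos (left S) (suc j) ≢ pos F (suc j)) → 4 * k ≤ n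
    merging-arms S U F {i} i≤κ i≡ i<
      with p , p≤κ , p≡ , p< ← last-meeting (left S) (left U)
      with r , r≤κ , r≡ , r< ← last-meeting (right U) F
      = ≤-trans (arith κ P e k≤) (count-arcs
          (full (left S) ∷ full (right S) ∷ full (right U) ∷ upper (left U) p≤κ ∷
           -- `F` counts only above its last meeting with `right U` and below the merger: levels
           -- `r + 2` to `i`.
           arc F (suc r) e (≤-trans (≤-reflexive e≡) (m≤n⇒m≤1+n i≤κ)) ∷ [])
          ( ( (λ _ j< _ _ → apart-sides S (s≤s⁻¹ j<))
            ∷ (λ _ j< _ _ → apart-sibling U (left S) (s≤s⁻¹ j<))
            ∷ (λ _ j< p<j _ → p< p<j (s≤s⁻¹ j<))
            ∷ (λ {j} _ _ _ j< → i< (subst (j <_) e≡ j<)) ∷ [])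
          ∷ ( (λ _ j< _ _ eq → c∉right (right U) (s≤s⁻¹ j<) (≡-sym eq))
            ∷ (λ _ j< _ _ eq → apart-sibling S (left U) (s≤s⁻¹ j<) (≡-sym eq))
            ∷ (λ _ j< _ _ eq → c∉right F (s≤s⁻¹ j<) (≡-sym eq)) ∷ [])
          ∷ ( (λ _ j< _ _ eq → apart-sides U (s≤s⁻¹ j<) (≡-sym eq))
            ∷ (λ _ j< r<j _ → r< r<j (s≤s⁻¹ j<)) ∷ [])
          ∷ ( (λ {j} _ j< _ _ eq → apart-sibling U′ F
                (s≤s⁻¹ (subst (j <_) (cong suc (m+[n∸m]≡n p≤κ)) j<)) (≡-sym eq)) ∷ [])
          ∷ [] ∷ [] ))
      where
      U′ = flip-spindle U
      P = κ ∸ p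
      e = i ∸ suc r
      -- Through the merger `c` reaches the end of `left S` in `κ` steps, so no arm of `c` may meet
      -- `right S`.
      c-on-left : Walk A κ c (pos (left S) k)
      c-on-left = switch F (left S) i≤κ (≡-sym i≡)
      c∉right : (G : Arm c) → Apart G (right S)
      c∉right G j≤κ eq = clash S c-on-left (switch G (right S) j≤κ eq)
      -- Otherwise `F`, `left S` and `left U` in turn lead from `c` to the end of `left U` in `κ`
      -- steps, against `clash`. The argument for `r<i` is the same with `a` and `right U`.
      p<i : p < i
      p<i with p <? i
      ... | yes lt = lt
      ... | no ≮ = ⊥-elim (clash U
        (climb (left U) p≤κ ≤-refl (subst (Walk A p c) p≡
          (climb (left S) (≮⇒≥ ≮) p≤κ (subst (Walk A i c) (≡-sym i≡) (own F i≤κ)))))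
        (own (right U) ≤-refl))
      r<i : r < i
      r<i with r <? i
      ... | yes lt = lt
      ... | no ≮ = ⊥-elim (clash U (own (left U) ≤-refl)
        (climb (right U) r≤κ ≤-refl (subst (Walk A r a) (≡-sym r≡)
          (climb F (≮⇒≥ ≮) r≤κ (subst (Walk A i a) i≡ (own (left S) i≤κ))))))
      e≡ : suc r + e ≡ i
      e≡ = m+[n∸m]≡n r<i
      len≡ : (i ∸ p) + ((i ∸ r) + ((κ ∸ r) + suc P)) ≡ suc ((P + suc e) + (P + suc e))
      len≡ = trans (cong₂ (λ x y → (i ∸ p) + (x + (y + suc P))) i∸r κ∸r)
               (trans (shuffle (i ∸ p) e (κ ∸ i) P)
                 (cong (λ x → suc ((x + suc e) + (P + suc e))) P≡))
        where
        i∸r : i ∸ r ≡ suc e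
        i∸r = trans (cong (_∸ r) (trans (≡-sym e≡) (≡-sym (+-suc r e)))) (m+n∸m≡n r (suc e))
        κ∸r : κ ∸ r ≡ (κ ∸ i) + suc e
        κ∸r = trans (cong (_∸ r) (trans (≡-sym (m∸n+n≡m i≤κ))
                (cong ((κ ∸ i) +_) (trans (≡-sym e≡) (trans (≡-sym (+-suc r e)) (+-comm r (suc e)))))))
                (trans (cong (_∸ r) (≡-sym (+-assoc (κ ∸ i) (suc e) r))) (m+n∸n≡m _ r))
        P≡ : (i ∸ p) + (κ ∸ i) ≡ P
        P≡ = trans (≡-sym (m+n∸n≡m _ p)) (cong (_∸ p) (trans (swap₃ (i ∸ p) (κ ∸ i) p)
               (trans (cong ((κ ∸ i) +_) (m∸n+n≡m (<⇒≤ p<i))) (m∸n+n≡m i≤κ))))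
          where
          swap₃ : ∀ x y z → x + y + z ≡ y + (x + z)
          swap₃ = solve-∀
        shuffle : ∀ x e y P → x + (suc e + (y + suc e + suc P)) ≡ suc ((x + y + suc e) + (P + suc e))
        shuffle = solve-∀
      -- Up `left S` to the merger, down `F`, up `right U`, across and down `left U`, turning at the
      -- last meetings: a closed walk of odd length `2 (P + e + 1) + 1`.
      k≤ : k ≤ P + suc e
      k≤ with P + suc e <? k
      ... | no ≮ = ≮⇒≥ ≮
      ... | yes lt = ⊥-elim (noOdd (P + suc e) len≡ lt
        (up (left S) (<⇒≤ p<i) i≤κ ++⟨ i≡ ⟩ down F (<⇒≤ r<i) i≤κ ++⟨ ≡-sym r≡ ⟩
         up (right U) r≤κ ≤-refl ++ʷ top U′ ∷
         subst (Walk A P _) (≡-sym p≡) (down (left U) p≤κ ≤-refl)))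
      arith : ∀ κ P e → suc κ ≤ P + suc e →
        4 * suc κ ≤ suc (suc κ + (suc κ + (suc κ + (P + (e + 0)))))
      arith κ P e le = subst₂ _≤_ (e₁ κ) (e₂ κ P e) (+-monoʳ-≤ (3 * suc κ) le)
        where
        e₁ : ∀ κ → 3 * suc κ + suc κ ≡ 4 * suc κ
        e₁ = solve-∀
        e₂ : ∀ κ P e → 3 * suc κ + (P + suc e) ≡ suc (suc κ + (suc κ + (suc κ + (P + (e + 0)))))
        e₂ = solve-∀

  private
    meeting : ∀ {s t} (F : Arm s) (G : Arm t) → Apart F G ⊎
      (∃ λ i → i ≤ κ × pos F (suc i) ≡ pos G (suc i) × (∀ {j} → j < i → pos F (suc j) ≢ pos G (suc j)))
    meeting F G with none-or-first (λ j → pos F (suc j) Fin.≟ pos G (suc j)) k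
    ... | inj₁ none = inj₁ λ j≤κ → none (s≤s j≤κ)
    ... | inj₂ (i , i<k , eq , before) = inj₂ (i , s≤s⁻¹ i<k , eq , before)

  -- The tested pairs are the arms leading to the same third neighbour; if one of them meets, the
  -- spindles are relabelled to fit `merging-arms`.
  three-spindles : ∀ {a b c} → Spindle a b → Spindle b c → Spindle c a → 4 * k ≤ n
  three-spindles S T U
    with meeting (left S) (right T) | meeting (right S) (left U) | meeting (left T) (right U)
  ... | inj₁ x | inj₁ y | inj₁ z = separated-arms S T U x y z
  ... | inj₂ (i , i≤κ , eq , before) | _ | _ =
    merging-arms S (flip-spindle U) (right T) i≤κ eq before
  ... | _ | inj₂ (i , i≤κ , eq , before) | _ =
    merging-arms (flip-spindle S) T (left U) i≤κ eq before
  ... | _ | _ | inj₂ (i , i≤κ , eq , before) =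
    merging-arms T (flip-spindle S) (right U) i≤κ eq before

  -- The given walk has length `2k - 1`; its middle edge becomes `top`.
  spindle : ∀ {s t} → A w s → A w t → Walk A (κ + suc κ) s t → Spindle s t
  spindle {s} {t} ws wt p with x , q , e ∷ r ← splitʷ κ p = record
    { left  = record { pos = at q′ ; pos-0 = refl ; pos-1 = refl ; trail = at-trail q′
                     ; back = subst (λ z → Walk A (suc k) z w) (≡-sym (at-last q′)) (e ∷ r ∷ʳʷ sy wt) }
    ; right = record { pos = at r′ ; pos-0 = refl ; pos-1 = refl ; trail = at-trail r′
                     ; back = subst (λ z → Walk A (suc k) z w) (≡-sym (at-last r′))
                                (sy e ∷ reverseʷ sy q ∷ʳʷ sy ws) }
    ; top = subst₂ A (≡-sym (at-last q′)) (≡-sym (at-last r′)) e }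
    where
    q′ = ws ∷ q
    r′ = wt ∷ reverseʷ sy r

-- Identifying two neighbours of a vertex.

Hom : {V W : Set} → Rel V 0ℓ → Rel W 0ℓ → Set
Hom {V} {W} A B = Σ (V → W) λ f → ∀ {x y} → A x y → B (f x) (f y)

module Identify {n κ} {A : Rel (Fin (suc n)) 0ℓ} (A? : Decidable A) (sy : Symmetric A)
  (noOdd : NoShortOdd A (suc κ)) {u v w} (u≢v : u ≢ v) (uw : A u w)
  (free : ¬ Walk A (κ + suc κ) u v) where

  private
    V = Fin (suc n)

    Ends : V → Set
    Ends x = x ≡ u ⊎ x ≡ v

    -- Steps back and forth along `uw` would pad a shorter odd walk to the forbidden length
    -- `2k - 1`.
    no-bridge : ∀ {h} → h ≤ κ → ¬ Walk A (suc (h + h)) u v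
    no-bridge {h} h≤κ p = free (subst (λ l → Walk A l u v) len (lengthen sy uw p (κ ∸ h)))
      where
      d = κ ∸ h
      shuffle : ∀ d h → (d + d) + suc (h + h) ≡ (d + h) + suc (d + h)
      shuffle = solve-∀
      len : (d + d) + suc (h + h) ≡ κ + suc κ
      len = trans (shuffle d h) (cong (λ l → l + suc l) (m∸n+n≡m h≤κ))

    no-odd-ends : ∀ {m h x y} → m ≡ suc (h + h) → h ≤ κ → Ends x → Ends y → ¬ Walk A m x y
    no-odd-ends refl h≤κ (inj₁ refl) (inj₁ refl) p = noOdd _ refl (s≤s h≤κ) p
    no-odd-ends refl h≤κ (inj₂ refl) (inj₂ refl) p = noOdd _ refl (s≤s h≤κ) p
    no-odd-ends refl h≤κ (inj₁ refl) (inj₂ refl) p = no-bridge h≤κ p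
    no-odd-ends refl h≤κ (inj₂ refl) (inj₁ refl) p = no-bridge h≤κ (reverseʷ sy p)

  π : V → Fin n
  π x with v Fin.≟ x
  -- `v` is removed from the index set and takes the place of `u`.
  ... | yes _ = punchOut (u≢v ∘ ≡-sym)
  ... | no v≢x = punchOut v≢x

  Image : Rel (Fin n) 0ℓ
  Image x′ y′ = ∃ λ x → ∃ λ y → π x ≡ x′ × π y ≡ y′ × A x y

  image? : Decidable Image
  image? x′ y′ = Fin.any? λ x → Fin.any? λ y →
    (π x Fin.≟ x′) ×-dec (π y Fin.≟ y′) ×-dec A? x y

  image-sym : Symmetric Image
  image-sym (x , y , πx , πy , e) = y , x , πy , πx , sy e

  private
    fibre : ∀ {x y} → π x ≡ π y → x ≡ y ⊎ (Ends x × Ends y)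
    fibre {x} {y} eq with v Fin.≟ x | v Fin.≟ y
    ... | yes v≡x | yes v≡y = inj₁ (trans (≡-sym v≡x) v≡y)
    ... | yes v≡x | no v≢y  = inj₂ (inj₂ (≡-sym v≡x) , inj₁ (≡-sym (Fin.punchOut-injective _ v≢y eq)))
    ... | no v≢x  | yes v≡y = inj₂ (inj₁ (Fin.punchOut-injective v≢x _ eq) , inj₂ (≡-sym v≡y))
    ... | no v≢x  | no v≢y  = inj₁ (Fin.punchOut-injective v≢x v≢y eq)

    -- Only the first and the last of the pieces into which a walk of the image
    -- breaks up are recorded: all other pieces run between ends, so are even.
    record Lifting (m : ℕ) (x′ y′ : Fin n) : Set where
      constructor lifting
      field
        {x y e d}  : V
        {l r} h    : ℕ
        πx   : π x ≡ x′
        πy   : π y ≡ y′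
        ends : Ends e × Ends d
        head : Walk A l x e
        tail : Walk A r d y
        len  : l + r + (h + h) ≡ m

    Lift : ℕ → Rel (Fin n) 0ℓ
    Lift m x′ y′ = (∃ λ x → ∃ λ y → π x ≡ x′ × π y ≡ y′ × Walk A m x y) ⊎ Lifting m x′ y′

    short : ∀ {m h} → m ≡ suc (h + h) → m < suc (suc κ + suc κ) → h ≤ κ
    short refl lt = s≤s⁻¹ (double-<⁻ lt)

    cons : ∀ {m x′ y′ z′} → m < suc (suc κ + suc κ) → Image x′ z′ → Lift m z′ y′ → Lift (suc m) x′ y′
    cons m< (x , z , πx , πz , xz) (inj₁ (z₁ , y , πz₁ , πy , p)) with fibre (trans πz (≡-sym πz₁))
    ... | inj₁ refl = inj₁ (x , y , πx , πy , xz ∷ p)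
    ... | inj₂ ends = inj₂ (lifting 0 πx πy ends (xz ∷ []) p (+-identityʳ _))
    cons {m} m< (x , z , πx , πz , xz) (inj₂ (lifting {l = l} {r} h πz₁ πy (e , d) p q len))
      with fibre (trans πz (≡-sym πz₁))
    ... | inj₁ refl = inj₂ (lifting h πx πy (e , d) (xz ∷ p) q (cong suc len))
    ... | inj₂ (z∈ , z₁∈) with parity l
    -- The former first piece now runs between ends, so it cannot be odd.
    ...   | inj₂ (i , l≡) = ⊥-elim (no-odd-ends {h = i} l≡
              (short l≡ (≤-<-trans (≤-trans (m≤m+n l r) (≤-trans (m≤m+n _ (h + h)) (≤-reflexive len))) m<))
              z₁∈ e p)
    ...   | inj₁ (i , refl) = inj₂ (lifting (i + h) πx πy (z∈ , d) (xz ∷ []) q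
              (cong suc (trans (shuffle i r h) len)))
      where
      shuffle : ∀ i r h → r + ((i + h) + (i + h)) ≡ (i + i) + r + (h + h)
      shuffle = solve-∀

    lift : ∀ {m x y} → suc m < suc (suc κ + suc κ) → Walk Image (suc m) x y → Lift (suc m) x y
    lift _ ((x , y , πx , πy , e) ∷ []) = inj₁ (x , y , πx , πy , e ∷ [])
    lift m< (e ∷ p@(_ ∷ _)) = cons (<⇒≤ m<) e (lift (<⇒≤ m<) p)

  -- The discarded pieces have even total length, so the first and last piece together are odd. If
  -- `x = y`, they join to an odd walk between ends; otherwise `x` and `y` are ends themselves, and
  -- one of the two pieces is such a walk.
  image-noOdd : NoShortOdd Image (suc κ)
  image-noOdd j refl j<k p with lift m< p
    where
    m< : suc (j + j) < suc (suc κ + suc κ)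
    m< = s≤s (+-mono-≤-< (<⇒≤ j<k) j<k)
  ... | inj₁ (x , y , πx , πy , q) with fibre (trans πx (≡-sym πy))
  ...   | inj₁ refl = noOdd j refl j<k q
  ...   | inj₂ (x∈ , y∈) = no-odd-ends {h = j} refl (s≤s⁻¹ j<k) x∈ y∈ q
  image-noOdd j refl j<k p | inj₂ (lifting {l = l} {r} h πx πy (e , d) q q′ len)
    with odd-+ (l + r) (h + h) {j} len
  ... | inj₂ (i , hh≡) = contradiction hh≡ (double≢odd h i)
  ... | inj₁ (i , lr≡) = final (fibre (trans πx (≡-sym πy)))
    where
    l+r< : l + r < suc (suc κ + suc κ)
    l+r< = ≤-<-trans (≤-trans (m≤m+n (l + r) (h + h)) (≤-reflexive len)) (s≤s (+-mono-≤-< (<⇒≤ j<k) j<k))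
    final : _ → ⊥
    final (inj₁ refl) = no-odd-ends {h = i} (trans (+-comm r l) lr≡) (short lr≡ l+r<) d e (q′ ++ʷ q)
    final (inj₂ (x∈ , y∈)) with odd-+ l r {i} lr≡
    ... | inj₁ (g , l≡) = no-odd-ends {h = g} l≡ (short l≡ (≤-<-trans (m≤m+n l r) l+r<)) x∈ e q
    ... | inj₂ (g , r≡) = no-odd-ends {h = g} r≡ (short r≡ (≤-<-trans (m≤n+m r l) l+r<)) d y∈ q′

  from-image : ∀ {W : Set} {B : Rel W 0ℓ} → Hom Image B → Hom A B
  from-image (f , h) = f ∘ π , λ {x} {y} e → h (x , y , refl , refl , e)

-- Deleting a vertex with at most one neighbour.

module Delete {n} {A : Rel (Fin (suc n)) 0ℓ} (sy : Symmetric A) (irr : ∀ {x} → ¬ A x x)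
  (A? : Decidable A) {w} (pendant : ∀ u v → A w u → A w v → u ≡ v) where

  Rest : Rel (Fin n) 0ℓ
  Rest x y = A (punchIn w x) (punchIn w y)

  -- `w` goes next to the image of its only neighbour, or to the default `t₀` if it is isolated.
  extend : ∀ {W : Set} {B : Rel W 0ℓ} → Symmetric B → (∀ t → ∃ (B t)) → W → Hom Rest B → Hom A B
  extend {W} {B} B-sym serial t₀ (f , h) = g , hom
    where
    image-of-w : Σ W λ t → ∀ {x} (w≢x : w ≢ x) → A w x → B t (f (punchOut w≢x))
    image-of-w with Fin.any? (λ x → A? w x)
    ... | no none = t₀ , λ _ e → contradiction (_ , e) none
    ... | yes (x , wx) with w Fin.≟ x
    ...   | yes refl = contradiction wx irr
    ...   | no w≢x with t , b ← serial (f (punchOut w≢x)) =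
      t , λ w≢y wy → B-sym (subst (λ z → B z t) (cong f (Fin.punchOut-cong w (pendant _ _ wx wy))) b)

    g : Fin (suc n) → W
    g x with w Fin.≟ x
    ... | yes _  = proj₁ image-of-w
    ... | no w≢x = f (punchOut w≢x)

    hom : ∀ {x y} → A x y → B (g x) (g y)
    hom {x} {y} e with w Fin.≟ x | w Fin.≟ y
    ... | yes refl | yes refl = contradiction e irr
    ... | yes refl | no w≢y = proj₂ image-of-w w≢y e
    ... | no w≢x | yes refl = B-sym (proj₂ image-of-w w≢x (sy e))
    ... | no w≢x | no w≢y = h (subst₂ A (≡-sym (Fin.punchIn-punchOut w≢x)) (≡-sym (Fin.punchIn-punchOut w≢y)) e)

-- Graphs in which every vertex has exactly two neighbours.

module TwoRegular {n κ} {A : Rel (Fin n) 0ℓ} (sy : Symmetric A)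
  (noOdd : NoShortOdd A (suc κ))
  (two : ∀ w → ∃ λ u → ∃ λ v → u ≢ v × A w u × A w v)
  (not-three : ∀ {w a b c} → A w a → A w b → A w c → a ≢ b → b ≢ c → c ≢ a → ⊥)
  (locked : ∀ {u v w} → u ≢ v → A w u → A w v → Walk A (κ + suc κ) u v) where

  private
    k = suc κ
    m = suc (k + k)

  cycle : ∀ x → Walk A m x x
  cycle x with u , v , u≢v , xu , xv ← two x = xu ∷ locked u≢v xu xv ∷ʳʷ sy xv

  module _ (x : Fin n) where

    private
      c = at (cycle x)
      c-trail = at-trail (cycle x)
      closed : c 0 ≡ c m
      closed = ≡-sym (at-last (cycle x))

    cycle-injective : ∀ {i j} → i < m → j < m → c i ≡ c j → i ≡ j
    cycle-injective {i} {j} i<m j<m eq with <-cmp i j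
    ... | tri≈ _ e _ = e
    ... | tri< lt _ _ with h , h<k , _ , p ← shorten-closed {j = k} c-trail closed lt j<m eq =
      ⊥-elim (noOdd h refl h<k p)
    ... | tri> _ _ gt with h , h<k , _ , p ← shorten-closed {j = k} c-trail closed gt i<m (≡-sym eq) =
      ⊥-elim (noOdd h refl h<k p)

    private
      next : ∀ {i} → i < m → ∃ λ j → j < m × CyclicNext m i j
      next {i} i<m with m≤n⇒m<n∨m≡n i<m
      ... | inj₁ lt = suc i , lt , inj₁ refl
      ... | inj₂ eq = 0 , s≤s z≤n , inj₂ (eq , refl)

      prev : ∀ {i} → i < m → ∃ λ j → j < m × CyclicNext m j i
      prev {zero} _ = k + k , ≤-refl , inj₂ (refl , refl)
      prev {suc i} lt = i , <⇒≤ lt , inj₁ refl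

      2≢m : 2 ≢ m
      2≢m eq with () ← trans (suc-injective (suc-injective eq)) (+-suc κ κ)

      next≢prev : ∀ {i j h} → CyclicNext m i j → CyclicNext m h i → j ≢ h
      next≢prev (inj₁ refl) (inj₁ i≡) j≡h = <⇒≢ (m≤n⇒m≤1+n ≤-refl) (trans i≡ (cong suc (≡-sym j≡h)))
      next≢prev (inj₁ refl) (inj₂ (h≡ , refl)) refl = 2≢m h≡
      next≢prev (inj₂ (i≡ , refl)) (inj₁ refl) refl = 2≢m i≡
      next≢prev (inj₂ (() , refl)) (inj₂ (_ , refl)) _

    -- Successor and predecessor are already two distinct neighbours, and a third is excluded.
    neighbour-on-cycle : ∀ {i y} → i < m → A (c i) y →
      ∃ λ j → j < m × c j ≡ y × (CyclicNext m i j ⊎ CyclicNext m j i)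
    neighbour-on-cycle {i} {y} i<m e with next i<m | prev i<m
    ... | s , s<m , i→s | p , p<m , p→i with c s Fin.≟ y | c p Fin.≟ y
    ...   | yes eq | _ = s , s<m , eq , inj₁ i→s
    ...   | _ | yes eq = p , p<m , eq , inj₂ p→i
    ...   | no s≢ | no p≢ = ⊥-elim (not-three
              (closed-trail {A = A} c-trail closed i<m i→s) (sy (closed-trail {A = A} c-trail closed p<m p→i)) e
              (λ eq → next≢prev i→s p→i (cycle-injective s<m p<m eq)) p≢ (s≢ ∘ ≡-sym))

    OnCycle : Fin n → Set
    OnCycle y = ∃ λ i → i < m × c i ≡ y

    walk-on-cycle : ∀ {l y z} → Walk A l y z → OnCycle y → OnCycle z
    walk-on-cycle [] on = on
    walk-on-cycle (e ∷ p) (i , i<m , refl) with j , j<m , eq , _ ← neighbour-on-cycle i<m e =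
      walk-on-cycle p (j , j<m , eq)

  -- If `y` were off the cycle through `x`, its own cycle would be disjoint from that one, giving
  -- `4k + 2` vertices.
  on-cycle : n < 4 * k → ∀ x y → OnCycle x y
  on-cycle n<4k x y with anyUpTo? (λ i → at (cycle x) i Fin.≟ y) m
  ... | yes on = on
  ... | no off = contradiction (subst (_≤ n) len (unique-length
      (Unique.++⁺ (unique x) (unique y) disjoint))) (<⇒≱ (<-trans n<4k (4k< κ)))
    where
    vertices : Fin n → List (Fin n)
    vertices z = applyUpTo (at (cycle z)) m
    unique : ∀ z → Unique (vertices z)
    unique z = Unique.applyUpTo⁺₁ (at (cycle z)) m λ i<j j<m eq →
      <⇒≢ i<j (cycle-injective z (<-trans i<j j<m) j<m eq)
    disjoint : Disjoint (vertices x) (vertices y)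
    disjoint (v∈x , v∈y) with i , i<m , refl ← ∈-applyUpTo⁻ (at (cycle x)) v∈x
      with j , j<m , eq ← ∈-applyUpTo⁻ (at (cycle y)) v∈y =
      off (walk-on-cycle x (reverseʷ sy (seg (at-trail (cycle y)) z≤n (<⇒≤ j<m))) (i , i<m , eq))
    len : length (vertices x ++ vertices y) ≡ m + m
    len = trans (length-++ (vertices x)) (cong₂ _+_ (length-applyUpTo (at (cycle x)) m) (length-applyUpTo (at (cycle y)) m))
    4k< : ∀ κ → 4 * suc κ < suc (suc κ + suc κ) + suc (suc κ + suc κ)
    4k< κ = subst (4 * suc κ <_) (arith κ) (m≤n+m (suc (4 * suc κ)) 1)
      where
      arith : ∀ κ → 1 + suc (4 * suc κ) ≡ suc (suc κ + suc κ) + suc (suc κ + suc κ)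
      arith = solve-∀

  -- The cycle through `x` is the whole graph, and it is laid along the closed walk `q` of the same
  -- length.
  cycle-hom : n < 4 * k → Fin n → ∀ {W : Set} {B : Rel W 0ℓ} → Symmetric B →
    ∀ {t} → Walk B m t t → Hom A B
  cycle-hom n<4k x {B = B} B-sym q = g ∘ index , hom
    where
    g = at q
    index : Fin n → ℕ
    index y = proj₁ (on-cycle n<4k x y)
    step : ∀ {i j} → i < m → CyclicNext m i j → B (g i) (g j)
    step = closed-trail {A = B} (at-trail q) (≡-sym (at-last q))
    hom : ∀ {y z} → A y z → B (g (index y)) (g (index z))
    hom {y} {z} e with i , i<m , refl ← on-cycle n<4k x y | j , j<m , ej ← on-cycle n<4k x z
      with h , h<m , eh , adj ← neighbour-on-cycle x i<m e
      with refl ← cycle-injective x j<m h<m (trans ej (≡-sym eh)) with adj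
    ... | inj₁ i→h = step i<m i→h
    ... | inj₂ h→i = B-sym (step h<m h→i)

-- Induction on the order.

two-neighbours? : ∀ {n} {A : Rel (Fin n) 0ℓ} → Decidable A →
  ∀ w → Dec (∃ λ u → ∃ λ v → u ≢ v × A w u × A w v)
two-neighbours? A? w = Fin.any? λ u → Fin.any? λ v → ¬? (u Fin.≟ v) ×-dec A? w u ×-dec A? w v

module _ {W : Set} {B : Rel W 0ℓ} (B-sym : Symmetric B) (serial : ∀ t → ∃ (B t))
         {κ} {t : W} (q : Walk B (suc (suc κ + suc κ)) t t) where

  -- Deletion first secures two neighbours everywhere, then identification locks all pairs of
  -- neighbours. What remains is two-regular or has three spindles at a vertex, which is too large.
  sparse-hom : ∀ n {A : Rel (Fin n) 0ℓ} → Decidable A → Symmetric A →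
    NoShortOdd A (suc κ) → n < 4 * suc κ → Hom A B
  sparse-hom zero A? sy noOdd n< = (λ ()) , λ { {()} }
  sparse-hom (suc n) {A} A? sy noOdd n<
    with Fin.all? (two-neighbours? A?)
  ... | no ¬two with w , ¬two-w ← Fin.¬∀⟶∃¬ _ _ (two-neighbours? A?) ¬two =
    Delete.extend sy irr A? pendant B-sym serial t
      (sparse-hom n (λ x y → A? _ _) sy (λ j eq j<k p → noOdd j eq j<k (map-walk (λ e → e) p)) (<⇒≤ n<))
    where
    irr : ∀ {x} → ¬ A x x
    irr e = noOdd 0 refl (s≤s z≤n) (e ∷ [])
    pendant : ∀ u v → A w u → A w v → u ≡ v
    pendant u v wu wv = decidable-stable (u Fin.≟ v) λ u≢v → ¬two-w (u , v , u≢v , wu , wv)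
  ... | yes two
    with Fin.any? (λ u → Fin.any? λ v → Fin.any? λ w →
      ¬? (u Fin.≟ v) ×-dec A? w u ×-dec A? w v ×-dec ¬? (walk? A? (κ + suc κ) u v))
  ...   | yes (u , v , w , u≢v , wu , wv , free) =
    from-image {B = B} (sparse-hom n image? image-sym image-noOdd (<⇒≤ n<))
    where open Identify A? sy noOdd u≢v (sy wu) free
  ...   | no ¬free
    with Fin.any? (λ w → Fin.any? λ a → Fin.any? λ b → Fin.any? λ c →
      A? w a ×-dec A? w b ×-dec A? w c ×-dec ¬? (a Fin.≟ b) ×-dec ¬? (b Fin.≟ c) ×-dec ¬? (c Fin.≟ a))
  ...     | no ¬three = TwoRegular.cycle-hom sy noOdd two
      (λ wa wb wc a≢b b≢c c≢a → ¬three (_ , _ , _ , _ , wa , wb , wc , a≢b , b≢c , c≢a))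
      (λ {u} {v} u≢v wu wv → decidable-stable (walk? A? _ u v)
         λ free → ¬free (_ , _ , _ , u≢v , wu , wv , free))
      n< Fin.zero B-sym q
  ...     | yes (w , a , b , c , wa , wb , wc , a≢b , b≢c , c≢a) =
      contradiction n< (≤⇒≯ (three-spindles (spindle wa wb (locked a≢b wa wb))
        (spindle wb wc (locked b≢c wb wc)) (spindle wc wa (locked c≢a wc wa))))
      where
      open Arms sy noOdd w
      locked : ∀ {u v} → u ≢ v → A w u → A w v → Walk A (κ + suc κ) u v
      locked {u} {v} u≢v wu wv = decidable-stable (walk? A? _ u v)
        λ free → ¬free (_ , _ , _ , u≢v , wu , wv , free)

-- The lower bound for η.

2*+1 : ∀ j → 2 * j + 1 ≡ suc (j + j)
2*+1 = solve-∀

-- Adjacency in a `Graph` need not be decidable. Since `4 * k ≤ n G` is stable, decidability at the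
-- finitely many pairs may be assumed under double negation.
¬¬-∀-Fin : ∀ n {P : Fin n → Set} → (∀ i → ¬ ¬ P i) → ¬ ¬ (∀ i → P i)
¬¬-∀-Fin zero    h ¬all = ¬all λ ()
¬¬-∀-Fin (suc n) h ¬all = h Fin.zero λ P0 → ¬¬-∀-Fin n (h ∘ Fin.suc) λ Ps →
  ¬all λ { Fin.zero → P0 ; (Fin.suc i) → Ps i }

cycle-sym : ∀ m → Symmetric (CycleAdj m)
cycle-sym m = Sum.swap

cycle-serial : ∀ m (i : Fin m) → ∃ (CycleAdj m i)
cycle-serial m i with m≤n⇒m<n∨m≡n (Fin.toℕ<n i)
... | inj₁ lt = fromℕ< lt , inj₁ (inj₁ (Fin.toℕ-fromℕ< lt))
cycle-serial (suc m) i | inj₂ eq = Fin.zero , inj₁ (inj₂ (eq , refl))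

cycle-walk : ∀ m → Walk (CycleAdj (suc m)) (suc m) Fin.zero Fin.zero
cycle-walk m = to m ≤-refl ∷ʳʷ inj₁ (inj₂ (cong suc (Fin.toℕ-fromℕ< ≤-refl) , refl))
  where
  to : ∀ i (i<m : i < suc m) → Walk (CycleAdj (suc m)) i Fin.zero (fromℕ< i<m)
  to zero    (s≤s z≤n) = []
  to (suc i) lt = to i (<⇒≤ lt) ∷ʳʷ
    inj₁ (inj₁ (trans (Fin.toℕ-fromℕ< lt) (cong suc (≡-sym (Fin.toℕ-fromℕ< (<⇒≤ lt))))))

oddGirth⇒noShortOdd : ∀ G {k} → OddGirth G (2 * k + 1) → NoShortOdd (Adj G) k
oddGirth⇒noShortOdd G {k} (_ , _ , none) j refl j<k p with h , h≤j , c ← odd-cycle G j p =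
  none h (+-monoˡ-< 1 (*-monoʳ-< 2 (≤-<-trans h≤j j<k))) (subst (HasCycle G) (≡-sym (2*+1 h)) c)

order-bound : ∀ k l → 1 ≤ k → l ≤ k → ∀ G → OddGirth G (2 * k + 1) →
  ¬ HomToCycle G (2 * l + 1) → 4 * k ≤ n G
order-bound k@(suc κ) l _ l≤k G girth ¬hom = decidable-stable (4 * k ≤? n G) λ ≰ →
  ¬¬-∀-Fin (n G) (λ u → ¬¬-∀-Fin (n G) λ v → ¬¬-excluded-middle) λ adj? →
  ¬hom′ (sparse-hom (cycle-sym M) (cycle-serial M) closed (n G) adj? (Graph.sym G)
    (oddGirth⇒noShortOdd G {k} girth) (≰⇒> ≰))
  where
  M = suc (l + l)
  d = k ∸ l
  ¬hom′ : ¬ Hom (Adj G) (CycleAdj M)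
  ¬hom′ = subst (λ m → ¬ Hom (Adj G) (CycleAdj m)) (2*+1 l) λ (f , h) → ¬hom (f , λ u v → h)
  len : (d + d) + M ≡ suc (k + k)
  len = trans (arith d l) (cong (λ x → suc (x + x)) (m∸n+n≡m l≤k))
    where
    arith : ∀ d l → (d + d) + suc (l + l) ≡ suc ((d + l) + (d + l))
    arith = solve-∀
  -- Once around the cycle, after `k - l` detours along an edge.
  closed : Walk (CycleAdj M) (suc (k + k)) Fin.zero Fin.zero
  closed = subst (λ m → Walk (CycleAdj M) m Fin.zero Fin.zero) len
    (lengthen (cycle-sym M) (proj₂ (cycle-serial M Fin.zero)) (cycle-walk (l + l)) d)

-- Iterated negation and colour counts.

flips : ℕ → Bool → Bool
flips zero    x = x
flips (suc m) x = not (flips m x)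

flips-+ : ∀ m n x → flips (m + n) x ≡ flips m (flips n x)
flips-+ zero    n x = refl
flips-+ (suc m) n x = cong not (flips-+ m n x)

flips-double : ∀ j x → flips (j + j) x ≡ x
flips-double zero    x = refl
flips-double (suc j) x = trans (cong (λ m → not (flips m x)) (+-suc j j))
  (trans (not-involutive _) (flips-double j x))

flips-parity : ∀ m n {j} → m + n ≡ j + j → ∀ x → flips m x ≡ flips n x
flips-parity m n {j} eq x = begin
  flips m x                       ≡⟨ cong (flips m) (flips-double j x) ⟨
  flips m (flips (j + j) x)       ≡⟨ cong (λ t → flips m (flips t x)) eq ⟨
  flips m (flips (m + n) x)       ≡⟨ cong (flips m) (flips-+ m n x) ⟩
  flips m (flips m (flips n x))   ≡⟨ flips-+ m m (flips n x) ⟨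
  flips (m + m) (flips n x)       ≡⟨ flips-double m (flips n x) ⟩
  flips n x                       ∎
  where open ≡-Reasoning

-- The number of colours in [o, o + i) other than c.
skip : ℕ → ℕ → ℕ → ℕ
skip c o zero = zero
skip c o (suc i) with o + i ≟ c
... | yes _ = skip c o i
... | no _  = suc (skip c o i)

skip-suc : ∀ c o i → o + i ≢ c → skip c o (suc i) ≡ suc (skip c o i)
skip-suc c o i ≢c with o + i ≟ c
... | yes eq = contradiction eq ≢c
... | no _   = refl

skip-+ : ∀ c o m n → skip c o (m + n) ≡ skip c o m + skip c (o + m) n
skip-+ c o m zero = trans (cong (skip c o) (+-identityʳ m)) (≡-sym (+-identityʳ _))
skip-+ c o m (suc n) rewrite +-suc m n with o + (m + n) ≟ c | o + m + n ≟ c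
... | yes _  | yes _  = skip-+ c o m n
... | no _   | no _   = trans (cong suc (skip-+ c o m n)) (≡-sym (+-suc _ _))
... | yes eq | no ≢c  = contradiction (trans (+-assoc o m n) eq) ≢c
... | no ≢c  | yes eq = contradiction (trans (≡-sym (+-assoc o m n)) eq) ≢c

skip-one : ∀ {c n} → c < n → suc (skip c 0 n) ≡ n
skip-one {c} {suc n} c<n with n ≟ c
... | yes refl = cong suc (skip-none n ≤-refl)
  where
  skip-none : ∀ i → i ≤ c → skip c 0 i ≡ i
  skip-none zero    _ = refl
  skip-none (suc i) i<c = trans (skip-suc c 0 i (<⇒≢ i<c)) (cong suc (skip-none i (<⇒≤ i<c)))
... | no n≢c = cong suc (skip-one (≤∧≢⇒< (s≤s⁻¹ c<n) (n≢c ∘ ≡-sym)))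

-- Winding numbers of walks in an odd cycle.

module Winding (l : ℕ) where

  open import Data.Integer using (+_; -[1+_])

  M : ℕ
  M = suc (l + l)

  -- Of the ℓ steps leading from x to y, h go down and the others up; z counts
  -- the turns around the cycle.
  record Winds (z : ℤ) (ℓ : ℕ) (x y : ℤ) : Set where
    constructor winds
    field
      h    : ℕ
      h≤ℓ  : h ≤ ℓ
      wind : y +ᶻ (+ h +ᶻ + h) ≡ x +ᶻ + ℓ +ᶻ + M *ᶻ z

  -- Reversal exchanges the steps up and down.
  reverse-winds : ∀ {z ℓ x y} → Winds z ℓ x y → Winds (- z) ℓ y x
  reverse-winds {z} {ℓ} {x} {y} (winds h h≤ℓ eq) = winds (ℓ ∸ h) (m∸n≤m ℓ h)
    (calc (+ M) z x y (+ h) (+ (ℓ ∸ h)) (+ ℓ) (cong +_ (≡-sym (m∸n+n≡m h≤ℓ))) eq)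
    where
    calc : ∀ M z x y h d ℓ → ℓ ≡ d +ᶻ h → y +ᶻ (h +ᶻ h) ≡ x +ᶻ ℓ +ᶻ M *ᶻ z → x +ᶻ (d +ᶻ d) ≡ y +ᶻ ℓ +ᶻ M *ᶻ (- z)
    calc M z x y h d ℓ refl eq = begin
      x +ᶻ (d +ᶻ d)                                             ≡⟨ e₁ M z x y h d ⟩
      (x +ᶻ (d +ᶻ h) +ᶻ M *ᶻ z) +ᶻ d +ᶻ - h +ᶻ M *ᶻ - z               ≡⟨ cong (λ t → t +ᶻ d +ᶻ - h +ᶻ M *ᶻ - z) eq ⟨
      (y +ᶻ (h +ᶻ h)) +ᶻ d +ᶻ - h +ᶻ M *ᶻ - z                       ≡⟨ e₂ M z y h d ⟩
      y +ᶻ (d +ᶻ h) +ᶻ M *ᶻ - z                                   ∎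
      where
      open ≡-Reasoning
      e₁ : ∀ M z x y h d → x +ᶻ (d +ᶻ d) ≡ (x +ᶻ (d +ᶻ h) +ᶻ M *ᶻ z) +ᶻ d +ᶻ - h +ᶻ M *ᶻ - z
      e₁ = ℤ.solve-∀
      e₂ : ∀ M z y h d → (y +ᶻ (h +ᶻ h)) +ᶻ d +ᶻ - h +ᶻ M *ᶻ - z ≡ y +ᶻ (d +ᶻ h) +ᶻ M *ᶻ - z
      e₂ = ℤ.solve-∀

  infixr 5 _++ᵂ_

  _++ᵂ_ : ∀ {z z′ ℓ ℓ′ x y u} → Winds z ℓ x y → Winds z′ ℓ′ y u → Winds (z +ᶻ z′) (ℓ + ℓ′) x u
  _++ᵂ_ {z} {z′} {ℓ} {ℓ′} {x} {y} {u} (winds h h≤ eq) (winds h′ h′≤ eq′) =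
    winds (h + h′) (+-mono-≤ h≤ h′≤) (calc (+ M) z z′ (+ ℓ) (+ ℓ′) x y u (+ h) (+ h′) eq eq′)
    where
    calc : ∀ M z z′ ℓ ℓ′ x y u h h′ → y +ᶻ (h +ᶻ h) ≡ x +ᶻ ℓ +ᶻ M *ᶻ z → u +ᶻ (h′ +ᶻ h′) ≡ y +ᶻ ℓ′ +ᶻ M *ᶻ z′ →
           u +ᶻ ((h +ᶻ h′) +ᶻ (h +ᶻ h′)) ≡ x +ᶻ (ℓ +ᶻ ℓ′) +ᶻ M *ᶻ (z +ᶻ z′)
    calc M z z′ ℓ ℓ′ x y u h h′ eq eq′ = begin
      u +ᶻ ((h +ᶻ h′) +ᶻ (h +ᶻ h′))               ≡⟨ e₁ u h h′ ⟩
      (u +ᶻ (h′ +ᶻ h′)) +ᶻ (h +ᶻ h)               ≡⟨ cong (_+ᶻ (h +ᶻ h)) eq′ ⟩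
      (y +ᶻ ℓ′ +ᶻ M *ᶻ z′) +ᶻ (h +ᶻ h)             ≡⟨ e₂ M z′ ℓ′ y h ⟩
      (y +ᶻ (h +ᶻ h)) +ᶻ ℓ′ +ᶻ M *ᶻ z′             ≡⟨ cong (λ t → t +ᶻ ℓ′ +ᶻ M *ᶻ z′) eq ⟩
      (x +ᶻ ℓ +ᶻ M *ᶻ z) +ᶻ ℓ′ +ᶻ M *ᶻ z′           ≡⟨ e₃ M z z′ ℓ ℓ′ x ⟩
      x +ᶻ (ℓ +ᶻ ℓ′) +ᶻ M *ᶻ (z +ᶻ z′)             ∎
      where
      open ≡-Reasoning
      e₁ : ∀ u h h′ → u +ᶻ ((h +ᶻ h′) +ᶻ (h +ᶻ h′)) ≡ (u +ᶻ (h′ +ᶻ h′)) +ᶻ (h +ᶻ h)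
      e₁ = ℤ.solve-∀
      e₂ : ∀ M z′ ℓ′ y h → (y +ᶻ ℓ′ +ᶻ M *ᶻ z′) +ᶻ (h +ᶻ h) ≡ (y +ᶻ (h +ᶻ h)) +ᶻ ℓ′ +ᶻ M *ᶻ z′
      e₂ = ℤ.solve-∀
      e₃ : ∀ M z z′ ℓ ℓ′ x → (x +ᶻ ℓ +ᶻ M *ᶻ z) +ᶻ ℓ′ +ᶻ M *ᶻ z′ ≡ x +ᶻ (ℓ +ᶻ ℓ′) +ᶻ M *ᶻ (z +ᶻ z′)
      e₃ = ℤ.solve-∀

  private
    cancel-base : ∀ {z ℓ x} (w : Winds z ℓ x x) → let h = Winds.h w in + h +ᶻ + h ≡ + ℓ +ᶻ + M *ᶻ z
    cancel-base {z} {ℓ} {x} (winds _ _ eq) = ∙-cancelˡ x _ _ (trans eq (ℤ.+-assoc x (+ ℓ) (+ M *ᶻ z)))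

  -- Here z = 2 y with h = e + M y, and 0 ≤ h ≤ 2 e leaves only y = 0.
  short-even-closed : ∀ {z x} e → e ≤ l + l → Winds z (e + e) x x → z ≡ 0ℤ
  short-even-closed {z} {x} e e≤ w@(winds h h≤ _) = small y h≡ z≡
    where
    -- Half of `z`, obtained without division from `2h = 2e + (2l + 1) z`.
    y = + h -ᶻ + e -ᶻ + l *ᶻ z
    eqn : + h +ᶻ + h ≡ (+ e +ᶻ + e) +ᶻ + M *ᶻ z
    eqn = cancel-base w
    z≡ : z ≡ y +ᶻ y
    z≡ = begin
      z                                                       ≡⟨ e₁ (+ e) (+ l) z ⟩
      ((+ e +ᶻ + e) +ᶻ (1ℤ +ᶻ (+ l +ᶻ + l)) *ᶻ z) -ᶻ (+ e +ᶻ + e) -ᶻ (+ l +ᶻ + l) *ᶻ z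
                                                              ≡⟨ cong (λ t → t -ᶻ (+ e +ᶻ + e) -ᶻ (+ l +ᶻ + l) *ᶻ z) eqn ⟨
      (+ h +ᶻ + h) -ᶻ (+ e +ᶻ + e) -ᶻ (+ l +ᶻ + l) *ᶻ z             ≡⟨ e₂ (+ h) (+ e) (+ l) z ⟩
      y +ᶻ y                                                   ∎
      where
      open ≡-Reasoning
      e₁ : ∀ e l z → z ≡ ((e +ᶻ e) +ᶻ (1ℤ +ᶻ (l +ᶻ l)) *ᶻ z) -ᶻ (e +ᶻ e) -ᶻ (l +ᶻ l) *ᶻ z
      e₁ = ℤ.solve-∀
      e₂ : ∀ h e l z → (h +ᶻ h) -ᶻ (e +ᶻ e) -ᶻ (l +ᶻ l) *ᶻ z ≡ (h -ᶻ e -ᶻ l *ᶻ z) +ᶻ (h -ᶻ e -ᶻ l *ᶻ z)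
      e₂ = ℤ.solve-∀
    h≡ : + h ≡ + e +ᶻ + M *ᶻ y
    h≡ = trans (e₁ (+ h) (+ e) (+ l) z) (trans (cong (λ t → + e +ᶻ y +ᶻ + l *ᶻ t) z≡) (e₂ (+ e) (+ l) y))
      where
      e₁ : ∀ h e l z → h ≡ e +ᶻ (h -ᶻ e -ᶻ l *ᶻ z) +ᶻ l *ᶻ z
      e₁ = ℤ.solve-∀
      e₂ : ∀ e l y → e +ᶻ y +ᶻ l *ᶻ (y +ᶻ y) ≡ e +ᶻ (1ℤ +ᶻ (l +ᶻ l)) *ᶻ y
      e₂ = ℤ.solve-∀
    small : ∀ y → + h ≡ + e +ᶻ + M *ᶻ y → z ≡ y +ᶻ y → z ≡ 0ℤ
    small (+ zero) _ z≡ = z≡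
    small (+ suc n) h≡ _ = contradiction h≤ (<⇒≱ (subst (e + e <_) (≡-sym h≡ℕ)
      (+-monoʳ-< e (≤-<-trans e≤ (m≤m*n M (suc n))))))
      where
      h≡ℕ : h ≡ e + M * suc n
      h≡ℕ = ℤ.+-injective (trans h≡ (cong (_+ᶻ_ (+ e)) (≡-sym (ℤ.pos-* M (suc n)))))
    small -[1+ n ] h≡ _ = contradiction e≤ (<⇒≱ (subst (l + l <_) (≡-sym e≡ℕ)
      (≤-trans (m≤m*n M (suc n)) (m≤n+m _ h))))
      where
      e₁ : ∀ e M y → e ≡ e +ᶻ M *ᶻ (- y) +ᶻ M *ᶻ y
      e₁ = ℤ.solve-∀
      e≡ℕ : e ≡ h + M * suc n
      e≡ℕ = ℤ.+-injective (trans (e₁ (+ e) (+ M) (+ suc n))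
        (cong₂ _+ᶻ_ (≡-sym h≡) (≡-sym (ℤ.pos-* M (suc n)))))

  -- Without turns the steps up and down balance, so the length is even.
  no-odd-closed : ∀ {x j} → ¬ Winds 0ℤ (suc (j + j)) x x
  no-odd-closed {x} {j} w@(winds h _ _) = double≢odd h j (ℤ.+-injective
    (trans (cancel-base w) (trans (cong (_+ᶻ_ (+ suc (j + j))) (ℤ.*-zeroʳ (+ M))) (ℤ.+-identityʳ _))))

  private
    next-winds : ∀ x y → CycleNext M x y → ∃ λ z → Winds z 1 (+ toℕ x) (+ toℕ y)
    next-winds x y (inj₁ eq) = 0ℤ , winds 0 z≤n
      (trans (cong (λ t → + t +ᶻ 0ℤ) eq) (e (+ M) (+ toℕ x)))
      where
      e : ∀ M x → (1ℤ +ᶻ x) +ᶻ 0ℤ ≡ x +ᶻ 1ℤ +ᶻ M *ᶻ 0ℤ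
      e = ℤ.solve-∀
    -- The step from `M - 1` to 0 goes up and then loses `M`, hence the turn `-1`.
    next-winds x y (inj₂ (last , first)) = - 1ℤ , winds 0 z≤n
      (trans (cong (λ t → + t +ᶻ 0ℤ) first)
        (trans (e (+ toℕ x)) (cong (λ t → + toℕ x +ᶻ 1ℤ +ᶻ t *ᶻ - 1ℤ) (cong +_ last))))
      where
      e : ∀ x → 0ℤ +ᶻ 0ℤ ≡ x +ᶻ 1ℤ +ᶻ (1ℤ +ᶻ x) *ᶻ - 1ℤ
      e = ℤ.solve-∀

  walk-winds : ∀ {ℓ x y} → Walk (CycleAdj M) ℓ x y → ∃ λ z → Winds z ℓ (+ toℕ x) (+ toℕ y)
  walk-winds {x = x} [] = 0ℤ , winds 0 z≤n (e (+ M) (+ toℕ x))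
    where
    e : ∀ M x → x +ᶻ (0ℤ +ᶻ 0ℤ) ≡ x +ᶻ 0ℤ +ᶻ M *ᶻ 0ℤ
    e = ℤ.solve-∀
  walk-winds (inj₁ n ∷ p) with z , w ← next-winds _ _ n | z′ , w′ ← walk-winds p = z +ᶻ z′ , w ++ᵂ w′
  walk-winds (inj₂ n ∷ p) with z , w ← next-winds _ _ n | z′ , w′ ← walk-winds p =
    - z +ᶻ z′ , reverse-winds w ++ᵂ w′

  -- The turns along the three quadrilaterals 0213, 0123, 0132 vanish, and
  -- their sum is twice the number of turns along the triangle 013.
  no-K₄ : ∀ {a b c k x₀ x₁ x₂ x₃ z₀₁ z₂₃ z₀₂ z₁₃ z₀₃ z₁₂} →
    a ≤ l → b ≤ l → c ≤ l → a + b + c ≡ suc (k + k) →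
    Winds z₀₁ a x₀ x₁ → Winds z₂₃ a x₂ x₃ →
    Winds z₀₂ b x₀ x₂ → Winds z₁₃ b x₁ x₃ →
    Winds z₀₃ c x₀ x₃ → Winds z₁₂ c x₁ x₂ → ⊥
  no-K₄ {a} {b} {c} {k} {x₀} {z₀₁ = z₀₁} {z₂₃} {z₀₂} {z₁₃} {z₀₃} {z₁₂} a≤ b≤ c≤ sum w₀₁ w₂₃ w₀₂ w₁₃ w₀₃ w₁₂ =
    no-odd-closed {x₀} {k} (subst₂ (λ z ℓ → Winds z ℓ x₀ x₀) triangle≡0
      (trans (≡-sym (+-assoc a b c)) sum) (w₀₁ ++ᵂ w₁₃ ++ᵂ reverse-winds w₀₃))
    where
    -- Opposite sides agree, so half the length is `p + q ≤ 2l`, as `short-even-closed` requires.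
    quad : ∀ {z x} p q → p ≤ l → q ≤ l → ∀ {ℓ} → ℓ ≡ (p + q) + (p + q) → Winds z ℓ x x → z ≡ 0ℤ
    quad p q p≤ q≤ refl w = short-even-closed (p + q) (+-mono-≤ p≤ q≤) w
    q₁ : z₀₂ +ᶻ (- z₁₂ +ᶻ (z₁₃ +ᶻ - z₀₃)) ≡ 0ℤ
    q₁ = quad b c b≤ c≤ (≡-sym (+-assoc b c (b + c)))
           (w₀₂ ++ᵂ reverse-winds w₁₂ ++ᵂ w₁₃ ++ᵂ reverse-winds w₀₃)
    q₂ : z₀₁ +ᶻ (z₁₂ +ᶻ (z₂₃ +ᶻ - z₀₃)) ≡ 0ℤ
    q₂ = quad a c a≤ c≤ (≡-sym (+-assoc a c (a + c)))
           (w₀₁ ++ᵂ w₁₂ ++ᵂ w₂₃ ++ᵂ reverse-winds w₀₃)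
    q₃ : z₀₁ +ᶻ (z₁₃ +ᶻ (- z₂₃ +ᶻ - z₀₂)) ≡ 0ℤ
    q₃ = quad a b a≤ b≤ (≡-sym (+-assoc a b (a + b)))
           (w₀₁ ++ᵂ w₁₃ ++ᵂ reverse-winds w₂₃ ++ᵂ reverse-winds w₀₂)
    t = z₀₁ +ᶻ (z₁₃ +ᶻ - z₀₃)
    regroup : ∀ z₀₁ z₂₃ z₀₂ z₁₃ z₀₃ z₁₂ → + 2 *ᶻ (z₀₁ +ᶻ (z₁₃ +ᶻ - z₀₃)) ≡
      (z₀₂ +ᶻ (- z₁₂ +ᶻ (z₁₃ +ᶻ - z₀₃))) +ᶻ ((z₀₁ +ᶻ (z₁₂ +ᶻ (z₂₃ +ᶻ - z₀₃))) +ᶻ (z₀₁ +ᶻ (z₁₃ +ᶻ (- z₂₃ +ᶻ - z₀₂))))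
    regroup = ℤ.solve-∀
    triangle≡0 : t ≡ 0ℤ
    triangle≡0 = ℤ.*-cancelˡ-≡ (+ 2) t 0ℤ
      (trans (regroup z₀₁ z₂₃ z₀₂ z₁₃ z₀₃ z₁₂) (cong₂ _+ᶻ_ q₁ (cong₂ _+ᶻ_ q₂ q₃)))

-- The subdivided K₄.

data Kind : Set where
  α β γ : Kind

-- The four corners are joined by paths with suc a′, suc b′ or suc c′ edges,
-- opposite edges of K₄ being subdivided equally often.
module Subdivision (a′ b′ c′ : ℕ) where

  len′ len offset : Kind → ℕ
  len′ α = a′
  len′ β = b′
  len′ γ = c′
  len p = suc (len′ p)
  offset α = 0
  offset β = len α
  offset γ = len α + len β

  -- The two sides of a kind are opposite edges of K₄, directed from the smaller corner to the
  -- larger as in `no-K₄`.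
  src tgt : Kind → Fin 2 → Fin 4
  src p 0F = 0F
  src α 1F = 2F
  src β 1F = 1F
  src γ 1F = 1F
  tgt α 0F = 1F
  tgt α 1F = 3F
  tgt β 0F = 2F
  tgt β 1F = 3F
  tgt γ 0F = 3F
  tgt γ 1F = 2F

  data Point : Set where
    corner : Fin 4 → Point
    inner  : ∀ p → Fin 2 → Fin (len′ p) → Point

  pt : Kind → Fin 2 → ℕ → Point
  pt p s zero = corner (src p s)
  pt p s (suc i) with i <? len′ p
  ... | yes i< = inner p s (fromℕ< i<)
  -- Index `len p`, and by default every larger one, is the far corner.
  ... | no _   = corner (tgt p s)

  record Edge (x y : Point) : Set where
    constructor edge
    field
      kind : Kind
      side : Fin 2
      i    : ℕ
      i<   : i < len kind
      ends : (x ≡ pt kind side i × y ≡ pt kind side (suc i)) ⊎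
             (y ≡ pt kind side i × x ≡ pt kind side (suc i))

    colour : ℕ
    colour = offset kind + i
  open Edge

  edge-sym : Symmetric Edge
  edge-sym (edge p s i i< e) = edge p s i i< (Sum.swap e)

  path : ∀ p s → Walk Edge (len p) (corner (src p s)) (corner (tgt p s))
  path p s = subst (Walk Edge (len p) (corner (src p s))) last
    (seg {A = Edge} {f = pt p s} (λ {i} i< → edge p s i i< (inj₁ (refl , refl))) z≤n ≤-refl)
    where
    last : pt p s (len p) ≡ corner (tgt p s)
    last with len′ p <? len′ p
    ... | yes lt = contradiction lt (<-irrefl refl)
    ... | no _ = refl

  module _ {k} (total : len α + len β + len γ ≡ suc (k + k)) where

    -- For each colour c, the 2-colouring χ c is constant on the edges of
    -- colour c and proper on all others: every odd closed walk uses every colour.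
    private
      run : ℕ → Kind → ℕ → ℕ
      run c p = skip c (offset p)

      -- Counts the edges of colour other than `c` on the direct path from corner 0.
      height : ℕ → Fin 4 → ℕ
      height c 0F = 0
      height c 1F = run c α (len α)
      height c 2F = run c β (len β)
      height c 3F = run c γ (len γ)

      χ : ℕ → Point → Bool
      χ c (corner v)    = flips (height c v) false
      χ c (inner p s i) = flips (run c p (suc (toℕ i)) + height c (src p s)) false

      -- Exactly one of the `2k + 1` colours is `c`. The sum being even makes the colouring
      -- consistent around triangles.
      heights : ∀ {c} → c < suc (k + k) → height c 1F + height c 2F + height c 3F ≡ k + k
      heights {c} c< = begin
        skip c 0 (len α) + skip c (len α) (len β) + skip c (len α + len β) (len γ)
          ≡⟨ cong (_+ skip c (len α + len β) (len γ)) (skip-+ c 0 (len α) (len β)) ⟨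
        skip c 0 (len α + len β) + skip c (len α + len β) (len γ)
          ≡⟨ skip-+ c 0 (len α + len β) (len γ) ⟨
        skip c 0 (len α + len β + len γ)
          ≡⟨ cong (skip c 0) total ⟩
        skip c 0 (suc (k + k))
          ≡⟨ suc-injective (skip-one c<) ⟩
        k + k ∎
        where open ≡-Reasoning

      -- A path avoiding corner 0 closes a triangle with two paths from it; by `heights` the third
      -- height has the parity of the other two together.
      χ-tgt : ∀ {c} → c < suc (k + k) → ∀ p s →
        flips (height c (tgt p s)) false ≡ flips (run c p (len p) + height c (src p s)) false
      χ-tgt {c} c< α 0F = cong (λ t → flips t false) (≡-sym (+-identityʳ (run c α (len α))))
      χ-tgt {c} c< β 0F = cong (λ t → flips t false) (≡-sym (+-identityʳ (run c β (len β))))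
      χ-tgt {c} c< γ 0F = cong (λ t → flips t false) (≡-sym (+-identityʳ (run c γ (len γ))))
      χ-tgt {c} c< α 1F = flips-parity (height c 3F) _ {k}
        (trans (arith (height c 1F) (height c 2F) (height c 3F)) (heights c<)) false
        where
        arith : ∀ x y z → z + (x + y) ≡ x + y + z
        arith = solve-∀
      χ-tgt {c} c< β 1F = flips-parity (height c 3F) _ {k}
        (trans (arith (height c 1F) (height c 2F) (height c 3F)) (heights c<)) false
        where
        arith : ∀ x y z → z + (y + x) ≡ x + y + z
        arith = solve-∀
      χ-tgt {c} c< γ 1F = flips-parity (height c 2F) _ {k}
        (trans (arith (height c 1F) (height c 2F) (height c 3F)) (heights c<)) false
        where
        arith : ∀ x y z → y + (z + x) ≡ x + y + z
        arith = solve-∀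

      χ-pt : ∀ {c} → c < suc (k + k) → ∀ p s {i} → i ≤ len p →
        χ c (pt p s i) ≡ flips (run c p i + height c (src p s)) false
      χ-pt c< p s {zero} _ = refl
      χ-pt {c} c< p s {suc i} i≤ with i <? len′ p
      ... | yes lt = cong (λ t → flips (run c p (suc t) + height c (src p s)) false) (Fin.toℕ-fromℕ< lt)
      ... | no ≮ with refl ← ≤-antisym (s≤s⁻¹ i≤) (≮⇒≥ ≮) = χ-tgt c< p s

      χ-next : ∀ {c} → c < suc (k + k) → ∀ p s {i} → i < len p → offset p + i ≢ c →
        χ c (pt p s (suc i)) ≡ not (χ c (pt p s i))
      χ-next {c} c< p s {i} i< ≢c = begin
        χ c (pt p s (suc i))                                  ≡⟨ χ-pt c< p s i< ⟩
        flips (run c p (suc i) + height c (src p s)) false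
          ≡⟨ cong (λ t → flips (t + height c (src p s)) false) (skip-suc c (offset p) i ≢c) ⟩
        not (flips (run c p i + height c (src p s)) false)    ≡⟨ cong not (χ-pt c< p s (<⇒≤ i<)) ⟨
        not (χ c (pt p s i))                                  ∎
        where open ≡-Reasoning

      χ-flip : ∀ {c} → c < suc (k + k) → ∀ {x y} (e : Edge x y) → colour e ≢ c → χ c y ≡ not (χ c x)
      χ-flip c< (edge p s i i< (inj₁ (refl , refl))) ≢c = χ-next c< p s i< ≢c
      χ-flip c< (edge p s i i< (inj₂ (refl , refl))) ≢c =
        ≡-sym (trans (cong not (χ-next c< p s i< ≢c)) (not-involutive _))

      colour-at : ∀ {m x y} → Walk Edge m x y → Fin m → ℕ
      colour-at (e ∷ p) Fin.zero    = colour e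
      colour-at (e ∷ p) (Fin.suc t) = colour-at p t

      -- As long as `c` is avoided, every step flips `χ c`; after an odd number of steps the walk
      -- has not returned.
      find : ∀ {c} → c < suc (k + k) → ∀ {m x y} (p : Walk Edge m x y) →
        (∃ λ t → colour-at p t ≡ c) ⊎ flips m (χ c x) ≡ χ c y
      find c< [] = inj₂ refl
      find {c} c< {suc m} {x} (e ∷ p) with colour e ≟ c | find c< p
      ... | yes eq | _ = inj₁ (Fin.zero , eq)
      ... | no _ | inj₁ (t , eq) = inj₁ (Fin.suc t , eq)
      ... | no ≢c | inj₂ eq = inj₂ (trans (≡-sym (trans (cong (flips m) (χ-flip c< e ≢c)) (flips-not m _))) eq)
        where
        flips-not : ∀ m x → flips m (not x) ≡ not (flips m x)
        flips-not zero    x = refl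
        flips-not (suc m) x = cong not (flips-not m x)

    -- All `2k + 1` colours occur, at distinct positions of the walk.
    edge-noOdd : NoShortOdd Edge k
    edge-noOdd {u = u} j refl j<k p = <⇒≱ j<k (half-≤ (Fin.injective⇒≤ {f = position} injective))
      where
      half-≤ : suc (k + k) ≤ suc (j + j) → k ≤ j
      half-≤ le with j <? k
      ... | yes lt = contradiction le (<⇒≱ (s≤s (+-mono-≤-< (<⇒≤ lt) lt)))
      ... | no ≮ = ≮⇒≥ ≮
      used : ∀ c → ∃ λ t → colour-at p t ≡ toℕ c
      used c with find (Fin.toℕ<n c) p
      ... | inj₁ found = found
      ... | inj₂ eq = contradiction
        (trans (≡-sym eq) (cong not (flips-double j (χ (toℕ c) u)))) (not-¬ refl)
      position : Fin (suc (k + k)) → Fin (suc (j + j))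
      position c = proj₁ (used c)
      injective : ∀ {c d} → position c ≡ position d → c ≡ d
      injective {c} {d} eq = Fin.toℕ-injective
        (trans (≡-sym (proj₂ (used c))) (trans (cong (colour-at p) eq) (proj₂ (used d))))

  order : ℕ
  order = 4 + 2 * (a′ + (b′ + c′))

  private
    Code : Set
    Code = Fin 4 ⊎ (Fin 2 × (Fin a′ ⊎ (Fin b′ ⊎ Fin c′)))

    fin↔code : Fin order ↔ Code
    fin↔code = (↔-id _ ⊎-↔ ((↔-id _ ×-↔ ((↔-id _ ⊎-↔ Fin.+↔⊎) ↔-∘ Fin.+↔⊎)) ↔-∘ Fin.*↔×)) ↔-∘ Fin.+↔⊎

    from-code : Code → Point
    from-code (inj₁ v)                        = corner v
    from-code (inj₂ (s , inj₁ i))             = inner α s i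
    from-code (inj₂ (s , inj₂ (inj₁ i)))      = inner β s i
    from-code (inj₂ (s , inj₂ (inj₂ i)))      = inner γ s i

    to-code : Point → Code
    to-code (corner v)    = inj₁ v
    to-code (inner α s i) = inj₂ (s , inj₁ i)
    to-code (inner β s i) = inj₂ (s , inj₂ (inj₁ i))
    to-code (inner γ s i) = inj₂ (s , inj₂ (inj₂ i))

    from-to : ∀ x → from-code (to-code x) ≡ x
    from-to (corner v)    = refl
    from-to (inner α s i) = refl
    from-to (inner β s i) = refl
    from-to (inner γ s i) = refl

  decode : Fin order → Point
  decode = from-code ∘ Inverse.to fin↔code

  encode : Point → Fin order
  encode = Inverse.from fin↔code ∘ to-code

  decode-encode : ∀ x → decode (encode x) ≡ x
  decode-encode x = trans (cong from-code (Inverse.strictlyInverseˡ fin↔code (to-code x))) (from-to x)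

  module _ {k} (1≤k : 1 ≤ k) (total : len α + len β + len γ ≡ suc (k + k)) where

    graph : Graph
    graph = record
      { n     = order
      ; Adj   = λ x y → Edge (decode x) (decode y)
      ; sym   = edge-sym
      ; irref = λ e → edge-noOdd total 0 refl 1≤k (e ∷ [])
      }

    private
      graph-path : ∀ p s → Walk (Adj graph) (len p) (encode (corner (src p s))) (encode (corner (tgt p s)))
      graph-path p s = map-walk {f = encode}
        (λ {x} {y} → subst₂ Edge (≡-sym (decode-encode x)) (≡-sym (decode-encode y))) (path p s)

      triangle : Walk (Adj graph) (suc (k + k)) (encode (corner 0F)) (encode (corner 0F))
      triangle = subst (λ m → Walk (Adj graph) m (encode (corner 0F)) (encode (corner 0F)))
        (trans (≡-sym (+-assoc (len α) (len β) (len γ))) total)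
        (graph-path α 0F ++ʷ graph-path β 1F ++ʷ
          reverseʷ {A = Adj graph} (λ {x} {y} → Graph.sym graph {x} {y}) (graph-path γ 0F))

      cycle⇒k≤ : ∀ j → HasCycle graph (suc (j + j)) → k ≤ j
      cycle⇒k≤ j (_ , c , _ , adj) with j <? k
      ... | no ≮ = ≮⇒≥ ≮
      ... | yes j<k = ⊥-elim (edge-noOdd total j refl j<k
        (map-walk {f = decode ∘ c} (adj _ _) (cycle-walk (j + j))))

    -- An odd cycle extracted from the triangle 013 has length at most `2k + 1`, and by `cycle⇒k≤`
    -- no less.
    graph-oddGirth : OddGirth graph (2 * k + 1)
    graph-oddGirth = (k , refl) , has-cycle , λ j lt c →
      <⇒≱ lt (+-monoˡ-≤ 1 (*-monoʳ-≤ 2 (cycle⇒k≤ j (subst (HasCycle graph) (2*+1 j) c))))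
      where
      has-cycle : HasCycle graph (2 * k + 1)
      has-cycle with h , h≤k , c ← odd-cycle graph k triangle
        with refl ← ≤-antisym h≤k (cycle⇒k≤ h c) = subst (HasCycle graph) (≡-sym (2*+1 h)) c

    graph-no-hom : ∀ {l} → len α ≤ l → len β ≤ l → len γ ≤ l → ¬ HomToCycle graph (2 * l + 1)
    graph-no-hom {l} α≤ β≤ γ≤ hom = no-K₄ {k = k} α≤ β≤ γ≤ total
      (winding α 0F) (winding α 1F) (winding β 0F) (winding β 1F) (winding γ 0F) (winding γ 1F)
      where
      open Winding l
      hom′ : HomToCycle graph M
      hom′ = subst (HomToCycle graph) (2*+1 l) hom
      winds-path = λ p s → walk-winds (map-walk {f = proj₁ hom′} (proj₂ hom′ _ _) (graph-path p s))
      winding = λ p s → proj₂ (winds-path p s)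

-- Choice of the path lengths and the value of η.

path-lengths : ∀ t i → i < 3 → ∃ λ a → ∃ λ b → ∃ λ c →
  a ≤ suc t × b ≤ suc t × c ≤ suc t × suc a + suc b + suc c ≡ suc (i + suc t * 3)
-- `2k + 1` is divided as evenly as possible: `i + 1` of the three paths get `t + 2` edges, the
-- others `t + 1`.
path-lengths t 0 _ = t , t , suc t , n≤1+n t , n≤1+n t , ≤-refl , arith t
  where
  arith : ∀ t → suc t + suc t + suc (suc t) ≡ suc (0 + suc t * 3)
  arith = solve-∀
path-lengths t 1 _ = t , suc t , suc t , n≤1+n t , ≤-refl , ≤-refl , arith t
  where
  arith : ∀ t → suc t + suc (suc t) + suc (suc t) ≡ suc (1 + suc t * 3)
  arith = solve-∀
path-lengths t 2 _ = suc t , suc t , suc t , ≤-refl , ≤-refl , ≤-refl , arith t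
  where
  arith : ∀ t → suc (suc t) + suc (suc t) + suc (suc t) ≡ suc (2 + suc t * 3)
  arith = solve-∀
path-lengths t (suc (suc (suc i))) (s≤s (s≤s (s≤s ())))

extremal-graph : ∀ k l t i → 1 ≤ k → i < 3 → 2 * k ≡ i + suc t * 3 → suc (suc t) ≤ l →
  Σ Graph λ G → n G ≡ 4 * k × OddGirth G (2 * k + 1) × ¬ HomToCycle G (2 * l + 1)
extremal-graph k l t i 1≤k i<3 2k≡ t<l
  with a , b , c , a≤ , b≤ , c≤ , sum≡ ← path-lengths t i i<3 =
  graph {k} 1≤k total , order≡ , graph-oddGirth 1≤k total ,
  graph-no-hom 1≤k total (≤-trans (s≤s a≤) t<l) (≤-trans (s≤s b≤) t<l) (≤-trans (s≤s c≤) t<l)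
  where
  open Subdivision a b c
  total : suc a + suc b + suc c ≡ suc (k + k)
  total = trans sum≡ (cong suc (trans (≡-sym 2k≡) (cong (k +_) (+-identityʳ k))))
  -- Like K₄, its subdivision has two more edges than vertices, and there are `2 (2k + 1)` edges.
  order≡ : order ≡ 4 * k
  order≡ = suc-injective (suc-injective (trans (e₁ a b c) (trans (cong (2 *_) total) (e₂ k))))
    where
    e₁ : ∀ a b c → 2 + (4 + 2 * (a + (b + c))) ≡ 2 * (suc a + suc b + suc c)
    e₁ = solve-∀
    e₂ : ∀ k → 2 * suc (k + k) ≡ 2 + 4 * k
    e₂ = solve-∀

theorem8 : (k l i : ℕ) → 3 ≤ k → 3 ≤ l → (2 * k) % 3 ≡ i →
    l ≤ k → 2 * k ≤ 3 * l + i ∸ 3 →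
    IsEta k l (4 * k)
theorem8 k l i 3≤k 3≤l refl l≤k 2k≤ =
  construct (2 * k / 3) (m≡m%n+[m/n]*n (2 * k) 3) , order-bound k l 1≤k l≤k
  where
  1≤k : 1 ≤ k
  1≤k = ≤-trans (s≤s z≤n) 3≤k
  i<3 : i < 3
  i<3 = m%n<n (2 * k) 3
  construct : ∀ q → 2 * k ≡ i + q * 3 →
    Σ Graph λ G → n G ≡ 4 * k × OddGirth G (2 * k + 1) × ¬ HomToCycle G (2 * l + 1)
  -- Quotient 0 would give `2k = i < 3`.
  construct zero eq = contradiction (subst (_< 3) (≡-sym (trans eq (+-identityʳ i))) i<3)
    (≤⇒≯ (≤-trans 3≤k (m≤m+n k (k + 0))))
  -- The upper bound on `2 * k` becomes `3 (t + 2) ≤ 3 l`; the truncated subtraction is exact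
  -- because `3 ≤ 3 * l + i`.
  construct (suc t) eq = extremal-graph k l t i 1≤k i<3 eq (*-cancelʳ-≤ (suc (suc t)) l 3
    (+-cancelˡ-≤ i _ _ (subst₂ _≤_ (trans (cong (_+ 3) eq) (e₁ i (suc t))) (e₂ l i)
      (m≤o∸n⇒m+n≤o (2 * k) (≤-trans 3≤l (≤-trans (m≤m+n l (2 * l)) (m≤m+n (3 * l) i))) 2k≤))))
    where
    e₁ : ∀ i q → i + q * 3 + 3 ≡ i + suc q * 3
    e₁ = solve-∀
    e₂ : ∀ l i → 3 * l + i ≡ i + l * 3
    e₂ = solve-∀
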